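{- Let $\lambda$ and $\mathbf{a}=(a_\ell)_{\ell\ge0}$, $\mathbf{b}=(b_{\ell,\ell'})_{\ell,\ell'\ge0}$, $\mathbf{c}=(c_{\ell,\ell'})_{\ell,\ell'\ge0}$, $\mathbf{d}=(d_{\ell,\ell'})_{\ell,\ell'\ge0}$, $\mathbf{e}=(e_\ell)_{\ell\ge0}$ be commuting indeterminates, and for $n\ge0$ let \[ \widehat{Q}_n(\mathbf{a},\mathbf{b},\mathbf{c},\mathbf{d},\mathbf{e},\lambda)=\sum_{\sigma\in\mathfrak{S}_n}\lambda^{\mathrm{cyc}(\sigma)}\prod_{i\in\mathrm{Cval}(\sigma)}a_{\mathrm{ucross}(i,\sigma)+\mathrm{unest}(i,\sigma)}\prod_{i\in\mathrm{Cpeak}(\sigma)}b_{\mathrm{lcross}(i,\sigma),\mathrm{lnest}(i,\sigma)}\prod_{i\in\mathrm{Cdfall}(\sigma)}c_{\mathrm{lcross}(i,\sigma),\mathrm{lnest}(i,\sigma)}\prod_{i\in\mathrm{Cdrise}(\sigma)}d_{\mathrm{ucross}(i,\sigma),\mathrm{unest}(i,\sigma)}\prod_{i\in\mathrm{Fix}(\sigma)}e_{\mathrm{psnest}(i,\sigma)}. \] Then \[ \sum_{n\ge0}\widehat{Q}_n t^n=\cfrac{1}{1-\gamma_0t-\cfrac{\beta_1t^2}{1-\gamma_1t-\cfrac{\beta_2t^2}{1-\cdots}}} \] as formal power series in $t$, where $\gamma_0=\lambda e_0$, $\gamma_n=\sum_{\xi=0}^{n-1}c_{n-1-\xi,\xi}+\sum_{\xi=0}^{n-1}d_{n-1-\xi,\xi}+\lambda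 e_n$ for $n\ge1$, and $\beta_n=(\lambda+n-1)\,a_{n-1}\sum_{\xi=0}^{n-1}b_{n-1-\xi,\xi}$ for $n\ge1$.
   Context: $\mathfrak{S}_n$ is the set of permutations of $[n]$. For $\sigma\in\mathfrak{S}_n$: $\mathrm{Cpeak}(\sigma)=\{i:\sigma^{ -1}(i)<i>\sigma(i)\}$, $\mathrm{Cval}(\sigma)=\{i:\sigma^{ -1}(i)>i<\sigma(i)\}$, $\mathrm{Cdrise}(\sigma)=\{i:\sigma^{ -1}(i)<i<\sigma(i)\}$, $\mathrm{Cdfall}(\sigma)=\{i:\sigma^{ -1}(i)>i>\sigma(i)\}$, $\mathrm{Fix}(\sigma)=\{i:\sigma(i)=i\}$. $\mathrm{cyc}(\sigma)$ is the number of cycles (fixed points included). $\mathrm{ucross}(j,\sigma)=\#\{(i,k,l):i<j<k<l,\ k=\sigma(i),\ l=\sigma(j)\}$, $\mathrm{unest}(j,\sigma)=\#\{(i,k,l):i<j<k<l,\ k=\sigma(j),\ l=\sigma(i)\}$, $\mathrm{lcross}(k,\sigma)=\#\{(i,j,l):i<j<k<l,\ i=\sigma(k),\ j=\sigma(l)\}$, $\mathrm{lnest}(k,\sigma)=\#\{(i,j,l):i<j<k<l,\ i=\sigma(l),\ j=\sigma(k)\}$, and for a fixed point $i$, $\mathrm{psnest}(i,\sigma)=\#\{j<i:\sigma(j)>i\}$. -}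

module Defs where

open import Level using (Level)
open import Data.Bool using (Bool; true; false; if_then_else_; _∧_; _∨_; not)
open import Data.Nat using (ℕ; zero; suc; _∸_; _<ᵇ_; _≤ᵇ_; _≡ᵇ_)
import Data.Nat as ℕ
open import Data.Fin using (Fin; toℕ)
open import Data.Maybe using (Maybe; just; nothing; maybe)
open import Data.Vec using (Vec; []; _∷_; lookup)
open import Data.List using (List; []; _∷_; map; concatMap; foldr; allFin; upTo)
open import Algebra.Bundles using (CommutativeRing)

-- Permutations of [n] (encoded as Fin n = {0,…,n-1}), enumerated
-- explicitly: all vectors σ : Vec (Fin n) n (σ(i) = lookup σ i), each
-- listed exactly once, filtered by injectivity.

allVecs : (n k : ℕ) → List (Vec (Fin n) k)
allVecs n zero    = [] ∷ []
allVecs n (suc k) = concatMap (λ i → map (i ∷_) (allVecs n k)) (allFin n)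

filterᵇ : ∀ {a} {A : Set a} → (A → Bool) → List A → List A
filterᵇ p []       = []
filterᵇ p (x ∷ xs) = if p x then x ∷ filterᵇ p xs else filterᵇ p xs

allᵇ : ∀ {a} {A : Set a} → (A → Bool) → List A → Bool
allᵇ p = foldr (λ x r → p x ∧ r) true

_=ᶠ_ : ∀ {n} → Fin n → Fin n → Bool
i =ᶠ j = toℕ i ≡ᵇ toℕ j

_<ᶠ_ : ∀ {n} → Fin n → Fin n → Bool
i <ᶠ j = toℕ i <ᵇ toℕ j

isInjective : ∀ {n} → Vec (Fin n) n → Bool
isInjective {n} σ =
  allᵇ (λ i → allᵇ (λ j → not (lookup σ i =ᶠ lookup σ j) ∨ (i =ᶠ j)) (allFin n)) (allFin n)

Perms : (n : ℕ) → List (Vec (Fin n) n)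
Perms n = filterᵇ isInjective (allVecs n n)

sumℕ : List ℕ → ℕ
sumℕ = foldr ℕ._+_ 0

count : ∀ {n} → (Fin n → Bool) → ℕ
count {n} P = sumℕ (map (λ i → if P i then 1 else 0) (allFin n))

count3 : ∀ {n} → (Fin n → Fin n → Fin n → Bool) → ℕ
count3 {n} P = sumℕ (map (λ x → sumℕ (map (λ y → count (P x y)) (allFin n))) (allFin n))

module _ {n : ℕ} (σ : Vec (Fin n) n) where

  σ· : Fin n → Fin n
  σ· i = lookup σ i

  preimage : Fin n → Maybe (Fin n)
  preimage i = foldr (λ j r → if σ· j =ᶠ i then just j else r) nothing (allFin n)

  inv< : Fin n → Bool
  inv< i = maybe (λ j → j <ᶠ i) false (preimage i)

  inv> : Fin n → Bool
  inv> i = maybe (λ j → i <ᶠ j) false (preimage i)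

  isCpeak isCval isCdrise isCdfall isFix : Fin n → Bool
  isCpeak  i = inv< i ∧ (σ· i <ᶠ i)
  isCval   i = inv> i ∧ (i <ᶠ σ· i)
  isCdrise i = inv< i ∧ (i <ᶠ σ· i)
  isCdfall i = inv> i ∧ (σ· i <ᶠ i)
  isFix    i = σ· i =ᶠ i

  ucross : Fin n → ℕ
  ucross j = count3 (λ i k l → (i <ᶠ j) ∧ (j <ᶠ k) ∧ (k <ᶠ l) ∧ (k =ᶠ σ· i) ∧ (l =ᶠ σ· j))

  unest : Fin n → ℕ
  unest j = count3 (λ i k l → (i <ᶠ j) ∧ (j <ᶠ k) ∧ (k <ᶠ l) ∧ (k =ᶠ σ· j) ∧ (l =ᶠ σ· i))

  lcross : Fin n → ℕ
  lcross k = count3 (λ i j l → (i <ᶠ j) ∧ (j <ᶠ k) ∧ (k <ᶠ l) ∧ (i =ᶠ σ· k) ∧ (j =ᶠ σ· l))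

  lnest : Fin n → ℕ
  lnest k = count3 (λ i j l → (i <ᶠ j) ∧ (j <ᶠ k) ∧ (k <ᶠ l) ∧ (i =ᶠ σ· l) ∧ (j =ᶠ σ· k))

  psnest : Fin n → ℕ
  psnest i = count (λ j → (j <ᶠ i) ∧ (i <ᶠ σ· j))

  iter : ℕ → Fin n → Fin n
  iter zero    i = i
  iter (suc m) i = σ· (iter m i)

  -- i is the smallest element of its cycle (cycle lengths are ≤ n)
  isCycleMin : Fin n → Bool
  isCycleMin i = allᵇ (λ m → toℕ i ≤ᵇ toℕ (iter m i)) (upTo n)

  cyc : ℕ
  cyc = count isCycleMin

-- Ring-valued part: an arbitrary commutative ring R plays the role of
-- the ring of polynomials in the commuting indeterminates.

module WithRing {ℓ₁ ℓ₂ : Level} (R : CommutativeRing ℓ₁ ℓ₂) where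
  open CommutativeRing R

  sumL : List Carrier → Carrier
  sumL = foldr _+_ 0#

  prodL : List Carrier → Carrier
  prodL = foldr _*_ 1#

  sumTo : ℕ → (ℕ → Carrier) → Carrier
  sumTo m f = sumL (map f (upTo m))

  pow : Carrier → ℕ → Carrier
  pow x zero    = 1#
  pow x (suc k) = x * pow x k

  natR : ℕ → Carrier
  natR zero    = 0#
  natR (suc k) = 1# + natR k

  prodOver : ∀ {n} → (Fin n → Bool) → (Fin n → Carrier) → Carrier
  prodOver {n} P f = prodL (map (λ i → if P i then f i else 1#) (allFin n))

  weight : (lam : Carrier) (a : ℕ → Carrier) (b c d : ℕ → ℕ → Carrier)
           (e : ℕ → Carrier) {n : ℕ} → Vec (Fin n) n → Carrier
  weight lam a b c d e σ =
    pow lam (cyc σ)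
    * prodOver (isCval σ)   (λ i → a (ucross σ i ℕ.+ unest σ i))
    * prodOver (isCpeak σ)  (λ i → b (lcross σ i) (lnest σ i))
    * prodOver (isCdfall σ) (λ i → c (lcross σ i) (lnest σ i))
    * prodOver (isCdrise σ) (λ i → d (ucross σ i) (unest σ i))
    * prodOver (isFix σ)    (λ i → e (psnest σ i))

  Qhat : (lam : Carrier) (a : ℕ → Carrier) (b c d : ℕ → ℕ → Carrier)
         (e : ℕ → Carrier) (n : ℕ) → Carrier
  Qhat lam a b c d e n = sumL (map (weight lam a b c d e) (Perms n))

  Series : Set ℓ₁
  Series = ℕ → Carrier

  zeroS : Series
  zeroS _ = 0#

  oneS : Series
  oneS zero    = 1#
  oneS (suc _) = 0#

  constS : Carrier → Series
  constS x zero    = x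
  constS x (suc _) = 0#

  _+S_ : Series → Series → Series
  (f +S g) k = f k + g k

  scaleS : Carrier → Series → Series
  scaleS x f k = x * f k

  tS : Series → Series
  tS f zero    = 0#
  tS f (suc k) = f k

  _*S_ : Series → Series → Series
  (f *S g) k = sumTo (suc k) (λ i → f i * g (k ∸ i))

  powS : Series → ℕ → Series
  powS u zero    = oneS
  powS u (suc k) = u *S powS u k

  -- 1/(1 - u) = Σ_k u^k, for u with zero constant term
  -- (u^k has no terms below t^k, so coefficient m only needs k ≤ m)
  geomS : Series → Series
  geomS u m = sumTo (suc m) (λ k → powS u k m)

  Jfrac : (γ β : ℕ → Carrier) → ℕ → ℕ → Series
  Jfrac γ β zero    h = zeroS
  Jfrac γ β (suc N) h =
    geomS (tS (constS (γ h)) +S tS (tS (scaleS (β (suc h)) (Jfrac γ β N (suc h)))))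

  γseq : (lam : Carrier) (c d : ℕ → ℕ → Carrier) (e : ℕ → Carrier) → ℕ → Carrier
  γseq lam c d e zero    = lam * e 0
  γseq lam c d e (suc m) =
    sumTo (suc m) (λ ξ → c (m ∸ ξ) ξ) + sumTo (suc m) (λ ξ → d (m ∸ ξ) ξ)
    + lam * e (suc m)

  -- β_0 is never used; set to 0
  βseq : (lam : Carrier) (a : ℕ → Carrier) (b : ℕ → ℕ → Carrier) → ℕ → Carrier
  βseq lam a b zero    = 0#
  βseq lam a b (suc m) = (lam + natR m) * a m * sumTo (suc m) (λ ξ → b (m ∸ ξ) ξ)

{-# OPTIONS --safe #-}
module Submission where

-- Write λ^cyc as a product over the cycle minima, so that the weight of σ becomes a
-- product of local weights, and build σ by treating the values j = n-1, …, 0 in turn: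
-- at j, decide σ(j) if σ(j) ≥ j and σ⁻¹(j) if σ⁻¹(j) ≥ j; if σ(j) < j, decide only
-- where σ(j) ranks among the images still to come.  The number h of open paths then
-- traces a Motzkin path and every local weight can be read off at its own step.  At a
-- cycle valley there are h choices of σ(j), all with the same weight except that exactly
-- one of them closes a cycle, hence the factor λ + h - 1; it does not depend on which
-- partial permutation was built before.  So the total weight of the completions depends
-- on j and h only, and it satisfies the recurrence of weighted Motzkin paths, whose
-- generating function is the J-fraction.

open import Defs
open import Level using (Level; _⊔_)
open import Data.Nat using (ℕ; zero; suc; _∸_; _<_; _≤_; z≤n; s≤s; _<?_; _≤?_)
import Data.Nat as ℕ
import Data.Nat.Properties as ℕₚ
open import Data.Bool using (Bool; true; false; if_then_else_; _∧_; _∨_; not)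
open import Data.Maybe using (just; nothing)
open import Data.Fin using (Fin; toℕ; fromℕ<; punchOut)
import Data.Fin.Properties as Finₚ
open import Data.Fin.Permutation.Components using (transpose; transpose-inverse)
open import Data.Product using (_×_; _,_; proj₁; proj₂; ∃; map₁; uncurry)
open import Data.Sum using (_⊎_; inj₁; inj₂; [_,_]′)
open import Data.Vec using (Vec; []; _∷_; lookup; tabulate)
import Data.Vec.Properties as Vecₚ
open import Data.List using (List; []; _∷_; map; foldr; allFin; upTo; length; _++_; concatMap)
import Data.List.Properties as Listₚ
open import Data.List.Membership.Propositional using (_∈_; _∉_)
open import Data.List.Membership.Propositional.Properties using (∈-allFin; ∈-upTo⁺; ∈-upTo⁻; ∈-map⁺; ∈-map⁻; ∈-++⁺ˡ; ∈-++⁺ʳ; ∈-++⁻; ∈-insert)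
import Data.List.Membership.DecPropositional as DecMembership
open import Data.List.Relation.Unary.Any as Any using (here; there)
open import Data.List.Relation.Unary.All as All using (All; []; _∷_)
import Data.List.Relation.Unary.All.Properties as Allₚ
open import Data.List.Relation.Unary.AllPairs as AllPairs using (AllPairs; []; _∷_)
open import Data.List.Relation.Unary.Unique.Propositional using (Unique)
import Data.List.Relation.Unary.Unique.Propositional.Properties as Uniqueₚ
import Data.List.Relation.Unary.Sorted.TotalOrder.Properties as Sortedₚ
open import Data.List.Relation.Binary.Permutation.Propositional as ↭ using (_↭_; ↭-sym; ↭⇒↭ₛ)
open import Data.List.Relation.Binary.Permutation.Propositional.Properties using (↭-length)
import Data.List.Relation.Binary.Permutation.Setoid.Properties as ↭ₛ
import Data.List.Sort ℕₚ.≤-decTotalOrder as Sort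
open import Relation.Nullary using (¬_; Dec; yes; no; contradiction; does; ¬?)
open import Relation.Nullary.Decidable using (dec-true; dec-false; _×-dec_; _→-dec_; map′)
open import Relation.Binary.PropositionalEquality as ≡ using (_≡_; _≢_; refl; cong; cong₂; subst; sym; trans)
open import Relation.Binary.Definitions using (tri<; tri≈; tri>)
import Relation.Binary.Reasoning.Setoid as SetoidReasoning
open import Algebra.Bundles using (CommutativeMonoid; CommutativeRing)
import Algebra.Properties.CommutativeSemigroup as CommutativeSemigroupₚ
import Algebra.Solver.Ring.NaturalCoefficients.Default as SemiringSolver
open import Function using (_∘_; id)

-- The upper statistics of j compare σ(j) with images above j of smaller indices. These images are
-- among the starts of the open paths, so they are known at step j although their preimages are not.
-- The lower statistics compare σ(j) with images below j of larger indices, which are still unknown;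
-- hence the ranking of the open ends, fixed as each end is created. This ranking leaves no freedom
-- later: if j is the image of an end at all, it is the image of the end ranked first. At a cycle
-- valley the end is thus forced and only the start σ(j) varies, and exactly one start lies on the
-- path of that end. Since a sees only ucross + unest, which counts the other h - 1 starts, it
-- cannot tell the starts apart; this is why a has one index while b, c and d have two. All sums run
-- over the whole of `allVecs`, with an indicator of compatibility with the current state, so no
-- bijection with labelled paths is built: the recurrence is proved for each σ separately and then
-- summed.

private variable
  a b ℓp ℓq : Level
  A : Set a
  B : Set b
  P : A → Set ℓp

-- Finite sums in a commutative monoid

module Sums {c ℓ : Level} (M : CommutativeMonoid c ℓ) where
  open CommutativeMonoid M renaming (refl to ≈-refl; sym to ≈-sym; trans to ≈-trans)
  open SetoidReasoning setoid
  open CommutativeSemigroupₚ commutativeSemigroup using (interchange)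

  ∑ : List A → (A → Carrier) → Carrier
  ∑ xs f = foldr _∙_ ε (map f xs)

  ∑-cong : (xs : List A) {f g : A → Carrier} → (∀ x → f x ≈ g x) → ∑ xs f ≈ ∑ xs g
  ∑-cong []       eq = ≈-refl
  ∑-cong (x ∷ xs) eq = ∙-cong (eq x) (∑-cong xs eq)

  ∑-cong-∈ : (xs : List A) {f g : A → Carrier} → (∀ {x} → x ∈ xs → f x ≈ g x) → ∑ xs f ≈ ∑ xs g
  ∑-cong-∈ []       eq = ≈-refl
  ∑-cong-∈ (x ∷ xs) eq = ∙-cong (eq (here refl)) (∑-cong-∈ xs (eq ∘ there))

  ∑-ε : (xs : List A) {f : A → Carrier} → (∀ {x} → x ∈ xs → f x ≈ ε) → ∑ xs f ≈ ε
  ∑-ε []       eq = ≈-refl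
  ∑-ε (x ∷ xs) eq = ≈-trans (∙-cong (eq (here refl)) (∑-ε xs (eq ∘ there))) (identityˡ ε)

  ∑-∙ : (xs : List A) (f g : A → Carrier) → ∑ xs (λ x → f x ∙ g x) ≈ ∑ xs f ∙ ∑ xs g
  ∑-∙ []       f g = ≈-sym (identityˡ ε)
  ∑-∙ (x ∷ xs) f g = ≈-trans (∙-congˡ (∑-∙ xs f g)) (interchange (f x) (g x) (∑ xs f) (∑ xs g))

  ∑-swap : (xs : List A) (ys : List B) (f : A → B → Carrier) →
           ∑ xs (λ x → ∑ ys (f x)) ≈ ∑ ys (λ y → ∑ xs (λ x → f x y))
  ∑-swap []       ys f = ≈-sym (∑-ε ys (λ _ → ≈-refl))
  ∑-swap (x ∷ xs) ys f = ≈-trans (∙-congˡ (∑-swap xs ys f)) (≈-sym (∑-∙ ys (f x) (λ y → ∑ xs (λ x → f x y))))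

  ∑-++ : (xs ys : List A) {f : A → Carrier} → ∑ (xs ++ ys) f ≈ ∑ xs f ∙ ∑ ys f
  ∑-++ []       ys = ≈-sym (identityˡ _)
  ∑-++ (x ∷ xs) ys = ≈-trans (∙-congˡ (∑-++ xs ys)) (≈-sym (assoc _ _ _))

  ∑-map : (h : A → B) (xs : List A) {f : B → Carrier} → ∑ (map h xs) f ≡ ∑ xs (f ∘ h)
  ∑-map h xs = cong (foldr _∙_ ε) (sym (Listₚ.map-∘ xs))

  ∑-concatMap : (h : A → List B) (xs : List A) {f : B → Carrier} →
                ∑ (concatMap h xs) f ≈ ∑ xs (λ x → ∑ (h x) f)
  ∑-concatMap h []       = ≈-refl
  ∑-concatMap h (x ∷ xs) = ≈-trans (∑-++ (h x) (concatMap h xs)) (∙-congˡ (∑-concatMap h xs))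

  ∑-↭ : {xs ys : List A} (f : A → Carrier) → xs ↭ ys → ∑ xs f ≈ ∑ ys f
  ∑-↭ f ↭.refl         = ≈-refl
  ∑-↭ f (↭.prep x p)   = ∙-congˡ (∑-↭ f p)
  ∑-↭ f (↭.swap x y p) = begin
    f x ∙ (f y ∙ _)  ≈⟨ ∙-congˡ (∙-congˡ (∑-↭ f p)) ⟩
    f x ∙ (f y ∙ _)  ≈⟨ assoc _ _ _ ⟨
    (f x ∙ f y) ∙ _  ≈⟨ ∙-congʳ (comm _ _) ⟩
    (f y ∙ f x) ∙ _  ≈⟨ assoc _ _ _ ⟩
    f y ∙ (f x ∙ _)  ∎
  ∑-↭ f (↭.trans p q)  = ≈-trans (∑-↭ f p) (∑-↭ f q)

  ∑-single : {xs : List A} {x₀ : A} {f : A → Carrier} → Unique xs → x₀ ∈ xs →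
             (∀ {x} → x ∈ xs → x ≢ x₀ → f x ≈ ε) → ∑ xs f ≈ f x₀
  ∑-single {xs = x ∷ xs} (x∉ ∷ _) (here refl) f≈ε =
    ≈-trans (∙-congˡ (∑-ε xs (λ x∈ → f≈ε (there x∈) (λ { refl → All.lookup x∉ x∈ refl })))) (identityʳ _)
  ∑-single {xs = x ∷ xs} (x∉ ∷ u) (there x₀∈) f≈ε =
    ≈-trans (∙-cong (f≈ε (here refl) (λ { refl → All.lookup x∉ x₀∈ refl })) (∑-single u x₀∈ (f≈ε ∘ there)))
          (identityˡ _)

  ∑Fin-single : ∀ {n} (x₀ : Fin n) {f : Fin n → Carrier} →
                (∀ x → x ≢ x₀ → f x ≈ ε) → ∑ (allFin n) f ≈ f x₀
  ∑Fin-single {n} x₀ f≈ε = ∑-single (Uniqueₚ.allFin⁺ n) (∈-allFin x₀) (λ {x} _ → f≈ε x)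

  -- Each `f x` is spread over the entries of `L` equal to `x`, of which there is one or none, and
  -- the two sums are exchanged; so `L` may come in any order.
  ∑Fin-restrict : ∀ {n} {L : List (Fin n)} {f : Fin n → Carrier} → Unique L →
                  (∀ x → x ∉ L → f x ≈ ε) → ∑ (allFin n) f ≈ ∑ L f
  ∑Fin-restrict {n} {L} {f} u f≈ε = begin
    ∑ (allFin n) f                               ≈⟨ ∑-cong (allFin n) row ⟩
    ∑ (allFin n) (λ x → ∑ L (λ l → δ x l))       ≈⟨ ∑-swap (allFin n) L δ ⟩
    ∑ L (λ l → ∑ (allFin n) (λ x → δ x l))       ≈⟨ ∑-cong L (λ l → ≈-trans (∑Fin-single l (λ x x≢l → off x≢l)) (on l)) ⟩
    ∑ L f                                        ∎
    where
    open DecMembership (Finₚ._≟_ {n}) using (_∈?_)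
    δ : Fin n → Fin n → Carrier
    δ x l = if does (x Finₚ.≟ l) then f x else ε
    on : ∀ l → δ l l ≈ f l
    on l with l Finₚ.≟ l
    ... | yes _ = ≈-refl
    ... | no l≢l = contradiction refl l≢l
    off : ∀ {x l} → x ≢ l → δ x l ≈ ε
    off {x} {l} x≢l with x Finₚ.≟ l
    ... | yes x≡l = contradiction x≡l x≢l
    ... | no _    = ≈-refl
    row : ∀ x → f x ≈ ∑ L (δ x)
    row x with x ∈? L
    ... | yes x∈ = ≈-sym (≈-trans (∑-single u x∈ (λ _ l≢x → off (l≢x ∘ sym))) (on x))
    ... | no x∉  = ≈-trans (f≈ε x x∉) (≈-sym (∑-ε L (λ l∈ → off (λ { refl → x∉ l∈ }))))

  -- The one place where it matters that `allVecs` lists every vector exactly once.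
  ∑-allVecs-single : ∀ {n k} (v₀ : Vec (Fin n) k) {f : Vec (Fin n) k → Carrier} →
                     (∀ v → v ≢ v₀ → f v ≈ ε) → ∑ (allVecs n k) f ≈ f v₀
  ∑-allVecs-single []                f≈ε = identityʳ _
  ∑-allVecs-single {n} {suc k} (i₀ ∷ v₀) {f} f≈ε = begin
    ∑ (allVecs n (suc k)) f
      ≈⟨ ∑-concatMap (λ i → map (i ∷_) (allVecs n k)) (allFin n) ⟩
    ∑ (allFin n) (λ i → ∑ (map (i ∷_) (allVecs n k)) f)
      ≈⟨ ∑-cong (allFin n) (λ i → reflexive (∑-map (i ∷_) (allVecs n k))) ⟩
    ∑ (allFin n) (λ i → ∑ (allVecs n k) (λ v → f (i ∷ v)))
      ≈⟨ ∑Fin-single i₀ (λ i i≢i₀ → ∑-ε (allVecs n k) (λ {v} _ → f≈ε (i ∷ v) (λ { refl → i≢i₀ refl }))) ⟩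
    ∑ (allVecs n k) (λ v → f (i₀ ∷ v))
      ≈⟨ ∑-allVecs-single v₀ (λ v v≢v₀ → f≈ε (i₀ ∷ v) (λ { refl → v≢v₀ refl })) ⟩
    f (i₀ ∷ v₀) ∎

  ∑-filterᵇ : (p : A → Bool) (xs : List A) {f : A → Carrier} →
              ∑ (filterᵇ p xs) f ≈ ∑ xs (λ x → if p x then f x else ε)
  ∑-filterᵇ p []       = ≈-refl
  ∑-filterᵇ p (x ∷ xs) with p x
  ... | true  = ∙-congˡ (∑-filterᵇ p xs)
  ... | false = ≈-trans (∑-filterᵇ p xs) (≈-sym (identityˡ _))

  ∑-upTo : ∀ m (f : ℕ → Carrier) → ∑ (upTo (suc m)) f ≡ f 0 ∙ ∑ (upTo m) (f ∘ suc)
  ∑-upTo m f = cong (λ xs → f 0 ∙ foldr _∙_ ε xs)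
    (trans (Listₚ.map-applyUpTo suc f m) (sym (Listₚ.map-applyUpTo (λ i → i) (f ∘ suc) m)))

  antidiagonal : ℕ → (ℕ → ℕ → Carrier) → Carrier
  antidiagonal m f = ∑ (upTo (suc m)) (λ ξ → f (m ∸ ξ) ξ)

  antidiagonal-last : ∀ m f → antidiagonal (suc m) f ≈ f (suc m) 0 ∙ antidiagonal m (λ p q → f p (suc q))
  antidiagonal-last m f = reflexive (∑-upTo (suc m) (λ ξ → f (suc m ∸ ξ) ξ))

  -- `antidiagonal` begins with `f m 0`, but recursions on lists produce `f 0 m` first, so that term
  -- has to be brought forward from the other end.
  antidiagonal-first : ∀ m f → antidiagonal (suc m) f ≈ f 0 (suc m) ∙ antidiagonal m (λ p q → f (suc p) q)
  antidiagonal-first zero    f = begin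
    f 1 0 ∙ (f 0 1 ∙ ε)  ≈⟨ ∙-congˡ (identityʳ _) ⟩
    f 1 0 ∙ f 0 1        ≈⟨ comm _ _ ⟩
    f 0 1 ∙ f 1 0        ≈⟨ ∙-congˡ (identityʳ _) ⟨
    f 0 1 ∙ (f 1 0 ∙ ε)  ∎
  antidiagonal-first (suc m) f = begin
    antidiagonal (suc (suc m)) f
      ≈⟨ antidiagonal-last (suc m) f ⟩
    f (suc (suc m)) 0 ∙ antidiagonal (suc m) (λ p q → f p (suc q))
      ≈⟨ ∙-congˡ (antidiagonal-first m (λ p q → f p (suc q))) ⟩
    f (suc (suc m)) 0 ∙ (f 0 (suc (suc m)) ∙ antidiagonal m (λ p q → f (suc p) (suc q)))
      ≈⟨ assoc _ _ _ ⟨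
    (f (suc (suc m)) 0 ∙ f 0 (suc (suc m))) ∙ antidiagonal m (λ p q → f (suc p) (suc q))
      ≈⟨ ∙-congʳ (comm _ _) ⟩
    (f 0 (suc (suc m)) ∙ f (suc (suc m)) 0) ∙ antidiagonal m (λ p q → f (suc p) (suc q))
      ≈⟨ assoc _ _ _ ⟩
    f 0 (suc (suc m)) ∙ (f (suc (suc m)) 0 ∙ antidiagonal m (λ p q → f (suc p) (suc q)))
      ≈⟨ ∙-congˡ (antidiagonal-last m (λ p q → f (suc p) q)) ⟨
    f 0 (suc (suc m)) ∙ antidiagonal (suc m) (λ p q → f (suc p) q) ∎

-- Counting, splitting and ranking

module ∑ℕ = Sums ℕₚ.+-0-commutativeMonoid

ι : {P : Set ℓp} → Dec P → ℕ
ι P? = if does P? then 1 else 0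

module _ {P : Set ℓp} where
  ι-yes : (P? : Dec P) → P → ι P? ≡ 1
  ι-yes P? pr = cong (if_then 1 else 0) (dec-true P? pr)

  ι-no : (P? : Dec P) → ¬ P → ι P? ≡ 0
  ι-no P? ¬pr = cong (if_then 1 else 0) (dec-false P? ¬pr)

  does-iff : {Q : Set ℓq} → (P → Q) → (Q → P) → (P? : Dec P) (Q? : Dec Q) → does P? ≡ does Q?
  does-iff f g P? (yes q) = dec-true P? (g q)
  does-iff f g P? (no ¬q) = dec-false P? (¬q ∘ f)

  ι-cong : {Q : Set ℓq} → (P → Q) → (Q → P) → (P? : Dec P) (Q? : Dec Q) → ι P? ≡ ι Q?
  ι-cong f g P? Q? = cong (if_then 1 else 0) (does-iff f g P? Q?)

∑-transport : ∀ {n} {L : List A} (ψ : A → Fin n) {f : Fin n → ℕ} → Unique (map ψ L) →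
              (∀ i → i ∉ map ψ L → f i ≡ 0) → ∑ℕ.∑ (allFin n) f ≡ ∑ℕ.∑ L (f ∘ ψ)
∑-transport {L = L} ψ u f≡0 = trans (∑ℕ.∑Fin-restrict u f≡0) (∑ℕ.∑-map ψ L)

∑-one : (xs : List A) {f : A → ℕ} → (∀ {x} → x ∈ xs → f x ≡ 1) → ∑ℕ.∑ xs f ≡ length xs
∑-one []       f≡1 = refl
∑-one (x ∷ xs) f≡1 = cong₂ ℕ._+_ (f≡1 (here refl)) (∑-one xs (f≡1 ∘ there))

module _ (κ : A → ℕ) where

  #below #above : List A → ℕ → ℕ
  #below L v = ∑ℕ.∑ L (λ x → ι (κ x <? v))
  #above L v = ∑ℕ.∑ L (λ x → ι (v <? κ x))

  -- Trichotomy summed over `L`, equality holding once because the keys are distinct. At a cycle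
  -- valley this makes ucross + unest the same for every choice of start.
  #below+#above : ∀ {L x} → Unique (map κ L) → x ∈ L → suc (#below L (κ x) ℕ.+ #above L (κ x)) ≡ length L
  #below+#above {L} {x} u x∈ = begin
    1 ℕ.+ (#below L (κ x) ℕ.+ #above L (κ x))
      ≡⟨ cong₂ ℕ._+_ (sym here-one) (sym (∑ℕ.∑-∙ L _ _)) ⟩
    ∑ℕ.∑ L (λ y → ι (κ y ℕ.≟ κ x)) ℕ.+ ∑ℕ.∑ L (λ y → ι (κ y <? κ x) ℕ.+ ι (κ x <? κ y))
      ≡⟨ ∑ℕ.∑-∙ L _ _ ⟨
    ∑ℕ.∑ L (λ y → ι (κ y ℕ.≟ κ x) ℕ.+ (ι (κ y <? κ x) ℕ.+ ι (κ x <? κ y)))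
      ≡⟨ ∑-one L (λ {y} _ → trichotomy (κ y) (κ x)) ⟩
    length L ∎
    where
    open ≡.≡-Reasoning
    here-one : ∑ℕ.∑ L (λ y → ι (κ y ℕ.≟ κ x)) ≡ 1
    here-one = begin
      ∑ℕ.∑ L (λ y → ι (κ y ℕ.≟ κ x))        ≡⟨ ∑ℕ.∑-map κ L ⟨
      ∑ℕ.∑ (map κ L) (λ v → ι (v ℕ.≟ κ x))  ≡⟨ ∑ℕ.∑-single u (∈-map⁺ κ x∈) (λ {v} _ v≢ → ι-no (v ℕ.≟ κ x) v≢) ⟩
      ι (κ x ℕ.≟ κ x)                       ≡⟨ ι-yes (κ x ℕ.≟ κ x) refl ⟩
      1 ∎
    trichotomy : ∀ m v → ι (m ℕ.≟ v) ℕ.+ (ι (m <? v) ℕ.+ ι (v <? m)) ≡ 1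
    trichotomy m v with ℕₚ.<-cmp m v
    ... | tri< m<v m≢v m≯v rewrite ι-no (m ℕ.≟ v) m≢v | ι-yes (m <? v) m<v | ι-no (v <? m) m≯v = refl
    ... | tri≈ m≮v m≡v m≯v rewrite ι-yes (m ℕ.≟ v) m≡v | ι-no (m <? v) m≮v | ι-no (v <? m) m≯v = refl
    ... | tri> m≮v m≢v m>v rewrite ι-no (m ℕ.≟ v) m≢v | ι-no (m <? v) m≮v | ι-yes (v <? m) m>v = refl

data ExactlyOne {A : Set a} (P : A → Set ℓp) : List A → Set (a ⊔ ℓp) where
  here  : ∀ {x xs} → P x → All (¬_ ∘ P) xs → ExactlyOne P (x ∷ xs)
  there : ∀ {x xs} → ¬ P x → ExactlyOne P xs → ExactlyOne P (x ∷ xs)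

module ExactlyOneₚ where
  ++⁺ˡ : ∀ {xs ys} → ExactlyOne P xs → All (¬_ ∘ P) ys → ExactlyOne P (xs ++ ys)
  ++⁺ˡ (here px ¬xs)  ¬ys = here px (Allₚ.++⁺ ¬xs ¬ys)
  ++⁺ˡ (there ¬px e1) ¬ys = there ¬px (++⁺ˡ e1 ¬ys)

  ++⁺ʳ : ∀ {xs ys} → All (¬_ ∘ P) xs → ExactlyOne P ys → ExactlyOne P (xs ++ ys)
  ++⁺ʳ []          e1 = e1
  ++⁺ʳ (¬px ∷ ¬xs) e1 = there ¬px (++⁺ʳ ¬xs e1)

  map⁺ : {f : A → B} {P : A → Set ℓp} {Q : B → Set ℓq} {xs : List A} →
         (∀ {x} → x ∈ xs → P x → Q (f x)) → (∀ {x} → x ∈ xs → Q (f x) → P x) →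
         ExactlyOne P xs → ExactlyOne Q (map f xs)
  map⁺ to from (here px ¬xs)  =
    here (to (here refl) px) (Allₚ.map⁺ (All.tabulate (λ x∈ → All.lookup ¬xs x∈ ∘ from (there x∈))))
  map⁺ to from (there ¬px e1) = there (¬px ∘ from (here refl)) (map⁺ (to ∘ there) (from ∘ there) e1)

  unique : ∀ {x : A} {xs} → Unique xs → x ∈ xs → ExactlyOne (_≡ x) xs
  unique (x∉ ∷ u) (here refl) = here refl (All.map (λ y≢ → y≢ ∘ sym) x∉)
  unique (y∉ ∷ u) (there x∈)  = there (λ { refl → All.lookup y∉ x∈ refl }) (unique u x∈)

-- The places where a new image can be inserted into the ranking of the open ends: m + 1 places for
-- m ends, with every pair of lengths of sum m occurring once.
splits : List A → List (List A × List A)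
splits []       = ([] , []) ∷ []
splits (x ∷ xs) = ([] , x ∷ xs) ∷ map (map₁ (x ∷_)) (splits xs)

splits-++ : ∀ (xs : List A) {s} → s ∈ splits xs → proj₁ s ++ proj₂ s ≡ xs
splits-++ []       (here refl) = refl
splits-++ (x ∷ xs) (here refl) = refl
splits-++ (x ∷ xs) (there s∈) with ∈-map⁻ (map₁ (x ∷_)) s∈
... | _ , s∈′ , refl = cong (x ∷_) (splits-++ xs s∈′)

Separates : (κ : A → ℕ) → ℕ → List A × List A → Set _
Separates κ v (xs , ys) = All (λ x → v < κ x) xs × All (λ y → κ y < v) ys

-- `κ` decreases along the list, so the entries above `v` form a prefix, and the cut just behind it
-- is the only possible one.
one-split-separates : (κ : A → ℕ) {v : ℕ} {xs : List A} → AllPairs (λ x y → κ y < κ x) xs →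
                      All (λ x → κ x ≢ v) xs → ExactlyOne (Separates κ v) (splits xs)
one-split-separates κ []                  []          = here ([] , []) []
one-split-separates κ {v} {x ∷ xs} (y<x ∷ dec) (x≢v ∷ ≢v) with ℕₚ.<-cmp (κ x) v
... | tri< x<v _ x≯v = here ([] , x<v ∷ All.map (λ y<x → ℕₚ.<-trans y<x x<v) y<x)
                            (Allₚ.map⁺ (All.universal (λ { _ (v<x ∷ _ , _) → x≯v v<x }) (splits xs)))
... | tri≈ _ x≡v _   = contradiction x≡v x≢v
... | tri> x≮v _ v<x = there (λ { (_ , x<v ∷ _) → x≮v x<v })
                             (ExactlyOneₚ.map⁺ (λ { _ (ps , qs) → v<x ∷ ps , qs }) (λ { _ (_ ∷ ps , qs) → ps , qs })
                                (one-split-separates κ dec ≢v))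

module RankSums {c ℓ : Level} (M : CommutativeMonoid c ℓ) where
  open CommutativeMonoid M renaming (refl to ≈-refl; sym to ≈-sym; trans to ≈-trans)
  open Sums M
  open SetoidReasoning setoid

  ∑-exactlyOne : {xs : List A} {f : A → Carrier} {y : Carrier} → ExactlyOne P xs →
                 (∀ {x} → x ∈ xs → P x → f x ≈ y) → (∀ {x} → x ∈ xs → ¬ P x → f x ≈ ε) → ∑ xs f ≈ y
  ∑-exactlyOne (here px ¬xs)  one none =
    ≈-trans (∙-cong (one (here refl) px) (∑-ε _ (λ x∈ → none (there x∈) (All.lookup ¬xs x∈)))) (identityʳ _)
  ∑-exactlyOne (there ¬px e1) one none =
    ≈-trans (∙-cong (none (here refl) ¬px) (∑-exactlyOne e1 (one ∘ there) (none ∘ there))) (identityˡ _)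

  ∑-splits : (xs : List A) (f : ℕ → ℕ → Carrier) →
             ∑ (splits xs) (λ s → f (length (proj₁ s)) (length (proj₂ s))) ≈ antidiagonal (length xs) f
  ∑-splits []       f = ≈-refl
  ∑-splits (x ∷ xs) f = begin
    f 0 (suc (length xs)) ∙ ∑ (map (map₁ (x ∷_)) (splits xs)) (λ s → f (length (proj₁ s)) (length (proj₂ s)))
      ≡⟨ cong (f 0 (suc (length xs)) ∙_) (∑-map (map₁ (x ∷_)) (splits xs)) ⟩
    f 0 (suc (length xs)) ∙ ∑ (splits xs) (λ s → f (suc (length (proj₁ s))) (length (proj₂ s)))
      ≈⟨ ∙-congˡ (∑-splits xs (λ p q → f (suc p) q)) ⟩
    f 0 (suc (length xs)) ∙ antidiagonal (length xs) (λ p q → f (suc p) q)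
      ≈⟨ antidiagonal-first (length xs) f ⟨
    antidiagonal (suc (length xs)) f ∎

  -- `ranks (suc m)` is `antidiagonal m` by computation, the form of the sums in `γseq`; `ranks 0`
  -- is empty, as height 0 requires.
  ranks : ℕ → (ℕ → ℕ → Carrier) → Carrier
  ranks h f = ∑ (upTo h) (λ ξ → f (h ∸ suc ξ) ξ)

  private
    below above : List ℕ → ℕ → ℕ
    below = #below (λ x → x)
    above = #above (λ x → x)

    ∑-ranks-increasing : ∀ {ys} → AllPairs _<_ ys → (f : ℕ → ℕ → Carrier) →
                         ∑ ys (λ y → f (below ys y) (above ys y)) ≈ ranks (length ys) f
    ∑-ranks-increasing []            f = ≈-refl
    ∑-ranks-increasing {y ∷ ys} (y< ∷ inc) f = begin
      f (below (y ∷ ys) y) (above (y ∷ ys) y) ∙ ∑ ys (λ z → f (below (y ∷ ys) z) (above (y ∷ ys) z))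
        ≈⟨ ∙-cong (reflexive (cong₂ f below-head above-head))
                  (∑-cong-∈ ys (λ z∈ → reflexive (cong₂ f (below-tail z∈) (above-tail z∈)))) ⟩
      f 0 (length ys) ∙ ∑ ys (λ z → f (suc (below ys z)) (above ys z))
        ≈⟨ ∙-congˡ (∑-ranks-increasing inc (λ p q → f (suc p) q)) ⟩
      f 0 (length ys) ∙ ranks (length ys) (λ p q → f (suc p) q)
        ≈⟨ ranks-first (length ys) ⟩
      ranks (suc (length ys)) f ∎
      where
      below-head : below (y ∷ ys) y ≡ 0
      below-head = cong₂ ℕ._+_ (ι-no (y <? y) (ℕₚ.<-irrefl refl))
        (∑ℕ.∑-ε ys (λ {z} z∈ → ι-no (z <? y) (ℕₚ.<-asym (All.lookup y< z∈))))
      above-head : above (y ∷ ys) y ≡ length ys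
      above-head = cong₂ ℕ._+_ (ι-no (y <? y) (ℕₚ.<-irrefl refl))
        (∑-one ys (λ {z} z∈ → ι-yes (y <? z) (All.lookup y< z∈)))
      below-tail : ∀ {z} → z ∈ ys → below (y ∷ ys) z ≡ suc (below ys z)
      below-tail {z} z∈ = cong (ℕ._+ below ys z) (ι-yes (y <? z) (All.lookup y< z∈))
      above-tail : ∀ {z} → z ∈ ys → above (y ∷ ys) z ≡ above ys z
      above-tail {z} z∈ = cong (ℕ._+ above ys z) (ι-no (z <? y) (ℕₚ.<-asym (All.lookup y< z∈)))
      ranks-first : ∀ m → f 0 m ∙ ranks m (λ p q → f (suc p) q) ≈ ranks (suc m) f
      ranks-first zero    = ≈-refl
      ranks-first (suc m) = ≈-sym (antidiagonal-first m f)

  -- Both counts are invariant under permutation, so the keys may be sorted. In an increasing list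
  -- the head has nothing below it, and it adds one to the lower count of every later entry.
  ∑-ranks : (κ : A → ℕ) {L : List A} → Unique (map κ L) → (f : ℕ → ℕ → Carrier) →
            ∑ L (λ x → f (#below κ L (κ x)) (#above κ L (κ x))) ≈ ranks (length L) f
  ∑-ranks κ {L} u f = begin
    ∑ L (λ x → f (#below κ L (κ x)) (#above κ L (κ x)))
      ≈⟨ ∑-cong L (λ x → reflexive (cong₂ f (sort-count (λ z → ι (z <? κ x))) (sort-count (λ z → ι (κ x <? z))))) ⟩
    ∑ L (λ x → f (below ys (κ x)) (above ys (κ x)))
      ≡⟨ ∑-map κ L ⟨
    ∑ (map κ L) (λ y → f (below ys y) (above ys y))
      ≈⟨ ∑-↭ _ (Sort.sort-↭ (map κ L)) ⟨
    ∑ ys (λ y → f (below ys y) (above ys y))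
      ≈⟨ ∑-ranks-increasing increasing f ⟩
    ranks (length ys) f
      ≡⟨ cong (λ m → ranks m f) (trans (↭-length (Sort.sort-↭ (map κ L))) (Listₚ.length-map κ L)) ⟩
    ranks (length L) f ∎
    where
    ys : List ℕ
    ys = Sort.sort (map κ L)
    sort-count : (g : ℕ → ℕ) → ∑ℕ.∑ L (g ∘ κ) ≡ ∑ℕ.∑ ys g
    sort-count g = trans (sym (∑ℕ.∑-map κ L)) (sym (∑ℕ.∑-↭ g (Sort.sort-↭ (map κ L))))
    increasing : AllPairs _<_ ys
    increasing = AllPairs.zipWith (uncurry ℕₚ.≤∧≢⇒<)
      ( Sortedₚ.Sorted⇒AllPairs ℕₚ.≤-totalOrder (Sort.sort-↗ (map κ L))
      , ↭ₛ.Unique-resp-↭ (≡.setoid ℕ) (↭⇒↭ₛ (↭-sym (Sort.sort-↭ (map κ L)))) u )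

-- Motzkin paths and J-fractions

module Fractions {ℓ₁ ℓ₂ : Level} (R : CommutativeRing ℓ₁ ℓ₂) where
  open CommutativeRing R renaming (refl to ≈-refl; sym to ≈-sym; trans to ≈-trans)
  open WithRing R
  open SetoidReasoning setoid
  open Sums +-commutativeMonoid public
  open SemiringSolver commutativeSemiring using (solve; _:=_; _:+_; _:*_)

  *-∑ : ∀ {a} {A : Set a} (xs : List A) {f : A → Carrier} (x : Carrier) → x * ∑ xs f ≈ ∑ xs (λ y → x * f y)
  *-∑ []       x = zeroʳ x
  *-∑ (y ∷ xs) x = ≈-trans (distribˡ _ _ _) (+-congˡ (*-∑ xs x))

  ∑-* : ∀ {a} {A : Set a} (xs : List A) {f : A → Carrier} (x : Carrier) → ∑ xs f * x ≈ ∑ xs (λ y → f y * x)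
  ∑-* xs x = ≈-trans (*-comm _ _) (≈-trans (*-∑ xs x) (∑-cong xs (λ _ → *-comm _ _)))

  ∑-upTo-extend : ∀ m d {f : ℕ → Carrier} → (∀ k → m ≤ k → f k ≈ 0#) → ∑ (upTo (m ℕ.+ d)) f ≈ ∑ (upTo m) f
  ∑-upTo-extend zero    d     f≈0 = ∑-ε (upTo d) (λ {k} _ → f≈0 k z≤n)
  ∑-upTo-extend (suc m) d {f} f≈0 = begin
    ∑ (upTo (suc (m ℕ.+ d))) f        ≡⟨ ∑-upTo (m ℕ.+ d) f ⟩
    f 0 + ∑ (upTo (m ℕ.+ d)) (f ∘ suc) ≈⟨ +-congˡ (∑-upTo-extend m d (λ k m≤k → f≈0 (suc k) (s≤s m≤k))) ⟩
    f 0 + ∑ (upTo m) (f ∘ suc)         ≡⟨ ∑-upTo m f ⟨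
    ∑ (upTo (suc m)) f                 ∎

  module _ {u : Series} (u₀≈0 : u 0 ≈ 0#) where

    *S-suc : ∀ p m → (u *S p) (suc m) ≈ ∑ (upTo (suc m)) (λ i → u (suc i) * p (m ∸ i))
    *S-suc p m = begin
      (u *S p) (suc m)
        ≡⟨ ∑-upTo (suc m) (λ i → u i * p (suc m ∸ i)) ⟩
      u 0 * p (suc m) + ∑ (upTo (suc m)) (λ i → u (suc i) * p (m ∸ i))
        ≈⟨ +-congʳ (≈-trans (*-congʳ u₀≈0) (zeroˡ _)) ⟩
      0# + ∑ (upTo (suc m)) (λ i → u (suc i) * p (m ∸ i))
        ≈⟨ +-identityˡ _ ⟩
      ∑ (upTo (suc m)) (λ i → u (suc i) * p (m ∸ i)) ∎

    powS-vanish : ∀ {k m} → m < k → powS u k m ≈ 0#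
    powS-vanish {suc k} {zero}  _         = ≈-trans (+-identityʳ _) (≈-trans (*-congʳ u₀≈0) (zeroˡ _))
    powS-vanish {suc k} {suc m} (s≤s m<k) = ≈-trans (*S-suc (powS u k) m)
      (∑-ε (upTo (suc m)) (λ {i} _ → ≈-trans (*-congˡ (powS-vanish (ℕₚ.≤-<-trans (ℕₚ.m∸n≤m m i) m<k))) (zeroʳ _)))

    geomS-truncate : ∀ {m m′} → m ≤ m′ → ∑ (upTo (suc m′)) (λ k → powS u k m) ≈ geomS u m
    geomS-truncate {m} {m′} m≤m′ =
      subst (λ x → ∑ (upTo (suc x)) (λ k → powS u k m) ≈ geomS u m) (ℕₚ.m+[n∸m]≡n m≤m′)
        (∑-upTo-extend (suc m) (m′ ∸ m) (λ k m<k → powS-vanish m<k))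

    -- This is g = 1 + u g, read coefficientwise. After the exchange of sums the powers run up to m
    -- even for the coefficient `m ∸ i`; the surplus powers vanish there, which is `geomS-truncate`.
    geomS-suc : ∀ m → geomS u (suc m) ≈ ∑ (upTo (suc m)) (λ i → u (suc i) * geomS u (m ∸ i))
    geomS-suc m = begin
      geomS u (suc m)
        ≡⟨ ∑-upTo (suc m) (λ k → powS u k (suc m)) ⟩
      0# + ∑ (upTo (suc m)) (λ k → powS u (suc k) (suc m))
        ≈⟨ +-identityˡ _ ⟩
      ∑ (upTo (suc m)) (λ k → powS u (suc k) (suc m))
        ≈⟨ ∑-cong (upTo (suc m)) (λ k → *S-suc (powS u k) m) ⟩
      ∑ (upTo (suc m)) (λ k → ∑ (upTo (suc m)) (λ i → u (suc i) * powS u k (m ∸ i)))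
        ≈⟨ ∑-swap (upTo (suc m)) (upTo (suc m)) (λ k i → u (suc i) * powS u k (m ∸ i)) ⟩
      ∑ (upTo (suc m)) (λ i → ∑ (upTo (suc m)) (λ k → u (suc i) * powS u k (m ∸ i)))
        ≈⟨ ∑-cong (upTo (suc m)) (λ i → *-∑ (upTo (suc m)) (u (suc i))) ⟨
      ∑ (upTo (suc m)) (λ i → u (suc i) * ∑ (upTo (suc m)) (λ k → powS u k (m ∸ i)))
        ≈⟨ ∑-cong (upTo (suc m)) (λ i → *-congˡ (geomS-truncate (ℕₚ.m∸n≤m m i))) ⟩
      ∑ (upTo (suc m)) (λ i → u (suc i) * geomS u (m ∸ i)) ∎

  Renewal : (v f : ℕ → Carrier) → Set ℓ₂
  Renewal v f = ∀ m → f (suc m) ≈ ∑ (upTo (suc m)) (λ i → v i * f (m ∸ i))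

  -- The bound `N` is there because a fraction cut at a finite depth has correct coefficients only
  -- up to that depth; the value at n uses `v` only below n.
  renewal-unique : ∀ {v v′ f f′} N → (∀ i → i < N → v i ≈ v′ i) → f 0 ≈ f′ 0 →
                   Renewal v f → Renewal v′ f′ → ∀ n → n ≤ N → f n ≈ f′ n
  renewal-unique {v} {v′} {f} {f′} N v≈v′ f₀≈f′₀ rec rec′ n n≤N = below n n ℕₚ.≤-refl n≤N
    where
    -- The recursion goes from `suc m` to every `m ∸ i`, so the extra bound `b` carries the
    -- induction.
    below : ∀ b n → n ≤ b → n ≤ N → f n ≈ f′ n
    below b       zero    _         _   = f₀≈f′₀
    below (suc b) (suc m) (s≤s m≤b) m<N = begin
      f (suc m)
        ≈⟨ rec m ⟩
      ∑ (upTo (suc m)) (λ i → v i * f (m ∸ i))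
        ≈⟨ ∑-cong-∈ (upTo (suc m)) (λ {i} i∈ → *-cong
             (v≈v′ i (ℕₚ.<-≤-trans (∈-upTo⁻ i∈) m<N))
             (below b (m ∸ i) (ℕₚ.≤-trans (ℕₚ.m∸n≤m m i) m≤b) (ℕₚ.≤-trans (ℕₚ.m∸n≤m m i) (ℕₚ.<⇒≤ m<N)))) ⟩
      ∑ (upTo (suc m)) (λ i → v′ i * f′ (m ∸ i))
        ≈⟨ rec′ m ⟨
      f′ (suc m) ∎

  -- Weighted Motzkin paths from height k to height 0 in n steps; u h weighs a rise
  -- from h to h + 1 and d h a fall from h + 1 to h.
  mutual
    motzkin : (γ u d : ℕ → Carrier) → ℕ → ℕ → Carrier
    motzkin γ u d zero    zero    = 1#
    motzkin γ u d zero    (suc k) = 0#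
    motzkin γ u d (suc n) k       =
      γ k * motzkin γ u d n k + u k * motzkin γ u d n (suc k) + motzkin-fall γ u d n k

    motzkin-fall : (γ u d : ℕ → Carrier) → ℕ → ℕ → Carrier
    motzkin-fall γ u d n zero    = 0#
    motzkin-fall γ u d n (suc k) = d k * motzkin γ u d n k

  -- Cut a path at its first visit to height 0.
  motzkin-first-passage : ∀ γ u d n k → motzkin γ u d n (suc k) ≈
    ∑ (upTo n) (λ i → motzkin (γ ∘ suc) (u ∘ suc) (d ∘ suc) i k * (d 0 * motzkin γ u d (n ∸ suc i) 0))
  motzkin-first-passage γ u d zero    k = ≈-refl
  motzkin-first-passage γ u d (suc n) k = begin
    γ (suc k) * M n (suc k) + u (suc k) * M n (suc (suc k)) + d k * M n k
      ≈⟨ +-cong (+-cong (*-congˡ (motzkin-first-passage γ u d n k))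
                        (*-congˡ (motzkin-first-passage γ u d n (suc k)))) (falls k) ⟩
    γ (suc k) * C k + u (suc k) * C (suc k) + (M′ 0 k * X n + F k)
      ≈⟨ rearrange _ _ _ _ ⟩
    M′ 0 k * X n + (γ (suc k) * C k + u (suc k) * C (suc k) + F k)
      ≈⟨ +-congˡ (+-congʳ (+-cong (*-∑ (upTo n) _) (*-∑ (upTo n) _))) ⟩
    M′ 0 k * X n + (∑ (upTo n) (λ i → γ (suc k) * (M′ i k * X (n ∸ suc i)))
                    + ∑ (upTo n) (λ i → u (suc k) * (M′ i (suc k) * X (n ∸ suc i))) + F k)
      ≈⟨ +-congˡ (≈-trans (∑-∙ (upTo n) _ _) (+-congʳ (∑-∙ (upTo n) _ _))) ⟨
    M′ 0 k * X n + ∑ (upTo n) (λ i → γ (suc k) * (M′ i k * X (n ∸ suc i))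
      + u (suc k) * (M′ i (suc k) * X (n ∸ suc i)) + motzkin-fall (γ ∘ suc) (u ∘ suc) (d ∘ suc) i k * X (n ∸ suc i))
      ≈⟨ +-congˡ (∑-cong (upTo n) (λ i → factor _ _ _ _ _ _)) ⟩
    M′ 0 k * X n + ∑ (upTo n) (λ i → M′ (suc i) k * X (n ∸ suc i))
      ≡⟨ ∑-upTo n (λ i → M′ i k * X (suc n ∸ suc i)) ⟨
    ∑ (upTo (suc n)) (λ i → M′ i k * X (suc n ∸ suc i)) ∎
    where
    M M′ : ℕ → ℕ → Carrier
    M  = motzkin γ u d
    M′ = motzkin (γ ∘ suc) (u ∘ suc) (d ∘ suc)
    X C F : ℕ → Carrier
    X m = d 0 * M m 0
    C k = ∑ (upTo n) (λ i → M′ i k * X (n ∸ suc i))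
    F k = ∑ (upTo n) (λ i → motzkin-fall (γ ∘ suc) (u ∘ suc) (d ∘ suc) i k * X (n ∸ suc i))
    -- `M′ 0 k` is a Kronecker delta: from height 1 the fall is itself the first visit to 0, while
    -- from higher up it is a step of the shifted path.
    falls : ∀ k → d k * M n k ≈ M′ 0 k * X n + F k
    falls zero    = ≈-sym (≈-trans (+-cong (*-identityˡ _) (∑-ε (upTo n) (λ _ → zeroˡ _))) (+-identityʳ _))
    falls (suc k) = begin
      d (suc k) * M n (suc k)  ≈⟨ *-congˡ (motzkin-first-passage γ u d n k) ⟩
      d (suc k) * C k          ≈⟨ *-∑ (upTo n) _ ⟩
      ∑ (upTo n) (λ i → d (suc k) * (M′ i k * X (n ∸ suc i)))  ≈⟨ ∑-cong (upTo n) (λ i → *-assoc _ _ _) ⟨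
      F (suc k)                ≈⟨ +-identityˡ _ ⟨
      0# + F (suc k)           ≈⟨ +-congʳ (zeroˡ _) ⟨
      M′ 0 (suc k) * X n + F (suc k) ∎
    rearrange : ∀ x y z w → x + y + (z + w) ≈ z + (x + y + w)
    rearrange = solve 4 (λ x y z w → (x :+ y :+ (z :+ w)) := (z :+ (x :+ y :+ w))) ≈-refl
    factor : ∀ g p v q f x → g * (p * x) + v * (q * x) + f * x ≈ (g * p + v * q + f) * x
    factor = solve 6 (λ g p v q f x → (g :* (p :* x) :+ v :* (q :* x) :+ f :* x) := ((g :* p :+ v :* q :+ f) :* x)) ≈-refl

  -- Moving the level into the sequences lets the induction on depth stay at height 0.
  Jfrac-shift : ∀ γ β N h → Jfrac γ β N (suc h) ≡ Jfrac (γ ∘ suc) (β ∘ suc) N h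
  Jfrac-shift γ β zero    h = refl
  Jfrac-shift γ β (suc N) h =
    cong (λ f → geomS (tS (constS (γ (suc h))) +S tS (tS (scaleS (β (suc (suc h))) f)))) (Jfrac-shift γ β N (suc h))

  -- Both sides satisfy a renewal equation: the fraction because it is a geometric series in `s`,
  -- the paths by their first return to height 0. A first return of length i + 1 has weight `v i`: a
  -- level step, or a rise and a fall around a path one level up, which the induction on `N`
  -- compares with the tail of the fraction.
  Jfrac≈motzkin : ∀ γ β u d → (∀ m → β (suc m) ≈ d m * u m) → ∀ n N → n < N →
                  Jfrac γ β N 0 n ≈ motzkin γ u d n 0
  Jfrac≈motzkin γ β u d β≈du n (suc N) (s≤s n≤N) =
    renewal-unique {v = λ i → s (suc i)} {v′ = v} N v≈ (+-identityʳ 1#) (geomS-suc {s} (+-identityʳ 0#)) motzkin-renewal n n≤N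
    where
    s : Series
    s = tS (constS (γ 0)) +S tS (tS (scaleS (β 1) (Jfrac γ β N 1)))
    M M′ : ℕ → ℕ → Carrier
    M  = motzkin γ u d
    M′ = motzkin (γ ∘ suc) (u ∘ suc) (d ∘ suc)
    v : ℕ → Carrier
    v zero    = γ 0
    v (suc i) = d 0 * u 0 * M′ i 0
    v≈ : ∀ i → i < N → s (suc i) ≈ v i
    v≈ zero    i<N = +-identityʳ _
    v≈ (suc i) i<N = begin
      0# + β 1 * Jfrac γ β N 1 i
        ≈⟨ +-identityˡ _ ⟩
      β 1 * Jfrac γ β N 1 i
        ≡⟨ cong (λ f → β 1 * f i) (Jfrac-shift γ β N 0) ⟩
      β 1 * Jfrac (γ ∘ suc) (β ∘ suc) N 0 i
        ≈⟨ *-cong (β≈du 0) (Jfrac≈motzkin (γ ∘ suc) (β ∘ suc) (u ∘ suc) (d ∘ suc) (β≈du ∘ suc) i N (ℕₚ.<⇒≤ i<N)) ⟩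
      d 0 * u 0 * M′ i 0 ∎
    motzkin-renewal : Renewal v (λ m → M m 0)
    motzkin-renewal m = begin
      γ 0 * M m 0 + u 0 * M m 1 + 0#
        ≈⟨ +-identityʳ _ ⟩
      γ 0 * M m 0 + u 0 * M m 1
        ≈⟨ +-congˡ (*-congˡ (motzkin-first-passage γ u d m 0)) ⟩
      γ 0 * M m 0 + u 0 * ∑ (upTo m) (λ i → M′ i 0 * (d 0 * M (m ∸ suc i) 0))
        ≈⟨ +-congˡ (*-∑ (upTo m) _) ⟩
      γ 0 * M m 0 + ∑ (upTo m) (λ i → u 0 * (M′ i 0 * (d 0 * M (m ∸ suc i) 0)))
        ≈⟨ +-congˡ (∑-cong (upTo m) (λ i → rearrange _ _ _ _)) ⟩
      γ 0 * M m 0 + ∑ (upTo m) (λ i → v (suc i) * M (m ∸ suc i) 0)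
        ≡⟨ ∑-upTo m (λ i → v i * M (m ∸ i) 0) ⟨
      ∑ (upTo (suc m)) (λ i → v i * M (m ∸ i) 0) ∎
      where
      rearrange : ∀ w x y z → w * (x * (y * z)) ≈ y * w * x * z
      rearrange = solve 4 (λ w x y z → w :* (x :* (y :* z)) := y :* w :* x :* z) ≈-refl

-- Permutations and their statistics

does-true : ∀ {p} {P : Set p} (P? : Dec P) → does P? ≡ true → P
does-true (yes p) _ = p

module _ {a : Level} {A : Set a} {p : A → Bool} where
  allᵇ-elim : ∀ {xs x} → allᵇ p xs ≡ true → x ∈ xs → p x ≡ true
  allᵇ-elim {y ∷ xs} all (here refl) with p y
  ... | true = refl
  allᵇ-elim {y ∷ xs} all (there x∈) with p y
  ... | true = allᵇ-elim all x∈

  allᵇ-intro : ∀ xs → (∀ {x} → x ∈ xs → p x ≡ true) → allᵇ p xs ≡ true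
  allᵇ-intro []       all = refl
  allᵇ-intro (x ∷ xs) all rewrite all (here refl) = allᵇ-intro xs (all ∘ there)

Injection : ∀ {n} → (Fin n → Fin n) → Set
Injection f = ∀ {i j} → f i ≡ f j → i ≡ j

injection-surjective : ∀ {n} {f : Fin n → Fin n} → Injection f → ∀ y → ∃ λ x → f x ≡ y
injection-surjective {suc n} {f} inj y with Finₚ.any? (λ x → f x Finₚ.≟ y)
... | yes found = found
... | no ¬found = contradiction
  (Finₚ.injective⇒≤ {f = λ x → punchOut (y≢ x)} (λ {i} {j} eq → inj (Finₚ.punchOut-injective (y≢ i) (y≢ j) eq)))
  ℕₚ.1+n≰n
  where
  y≢ : ∀ x → y ≢ f x
  y≢ x y≡ = ¬found (x , sym y≡)

isInjective⇒injection : ∀ {n} (σ : Vec (Fin n) n) → isInjective σ ≡ true → Injection (lookup σ)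
isInjective⇒injection {n} σ ok {i} {j} eq
  with allᵇ-elim (allᵇ-elim ok (∈-allFin i)) (∈-allFin j)
... | ok′ rewrite dec-true (toℕ (lookup σ i) ℕ.≟ toℕ (lookup σ j)) (cong toℕ eq) =
  Finₚ.toℕ-injective (does-true (toℕ i ℕ.≟ toℕ j) ok′)

injection⇒isInjective : ∀ {n} (σ : Vec (Fin n) n) → Injection (lookup σ) → isInjective σ ≡ true
injection⇒isInjective {n} σ inj = allᵇ-intro (allFin n) (λ {i} _ → allᵇ-intro (allFin n) (λ {j} _ → test i j))
  where
  test : ∀ i j → not (lookup σ i =ᶠ lookup σ j) ∨ (i =ᶠ j) ≡ true
  test i j with toℕ (lookup σ i) ℕ.≟ toℕ (lookup σ j)
  ... | no neq rewrite dec-false (toℕ (lookup σ i) ℕ.≟ toℕ (lookup σ j)) neq = refl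
  ... | yes eq rewrite dec-true (toℕ (lookup σ i) ℕ.≟ toℕ (lookup σ j)) eq =
    dec-true (toℕ i ℕ.≟ toℕ j) (cong toℕ (inj (Finₚ.toℕ-injective eq)))

module Statistics {n : ℕ} (σ : Vec (Fin n) n) (inj : Injection (lookup σ)) where

  private
    s : Fin n → Fin n
    s = lookup σ

  preimage-just : ∀ {i j} → s i ≡ j → preimage σ j ≡ just i
  preimage-just {i} {j} si≡j = search (allFin n) (∈-allFin i)
    where
    search : ∀ xs → i ∈ xs → foldr (λ x r → if s x =ᶠ j then just x else r) nothing xs ≡ just i
    search (x ∷ xs) (here refl) rewrite dec-true (toℕ (s x) ℕ.≟ toℕ j) (cong toℕ si≡j) = refl
    search (x ∷ xs) (there i∈) with toℕ (s x) ℕ.≟ toℕ j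
    ... | yes eq rewrite dec-true (toℕ (s x) ℕ.≟ toℕ j) eq =
      cong just (inj (trans (Finₚ.toℕ-injective eq) (sym si≡j)))
    ... | no neq rewrite dec-false (toℕ (s x) ℕ.≟ toℕ j) neq = search xs i∈

  inv<-preimage : ∀ {i j} → s i ≡ j → inv< σ j ≡ (i <ᶠ j)
  inv<-preimage eq rewrite preimage-just eq = refl

  inv>-preimage : ∀ {i j} → s i ≡ j → inv> σ j ≡ (j <ᶠ i)
  inv>-preimage eq rewrite preimage-just eq = refl

  private
    _≟_ : (i j : Fin n) → Dec (toℕ i ≡ toℕ j)
    i ≟ j = toℕ i ℕ.≟ toℕ j

    ∑-collapse : {P : Fin n → Set} (P? : ∀ i → Dec (P i)) (i₀ : Fin n) → (∀ {i} → P i → toℕ i ≡ toℕ i₀) →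
                 ∑ℕ.∑ (allFin n) (λ i → ι (P? i)) ≡ ι (P? i₀)
    ∑-collapse P? i₀ only = ∑ℕ.∑Fin-single i₀ (λ i i≢i₀ → ι-no (P? i) (i≢i₀ ∘ Finₚ.toℕ-injective ∘ only))

  -- The Boolean tests of Defs are definitionally the does of the corresponding Dec, so the
  -- counts unfold to sums of ι.
  ucross-count : ∀ j → ucross σ j ≡
    ∑ℕ.∑ (allFin n) (λ i → ι (i Finₚ.<? j ×-dec j Finₚ.<? s i ×-dec s i Finₚ.<? s j))
  ucross-count j = ∑ℕ.∑-cong (allFin n) (λ i →
    trans (∑ℕ.∑-cong (allFin n) (λ k → ∑-collapse (D? i k) (s j) (λ { (_ , _ , _ , _ , eq) → eq })))
    (trans (∑-collapse (λ k → D? i k (s j)) (s i) (λ { (_ , _ , _ , eq , _) → eq }))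
    (ι-cong (λ { (p , q , r , _) → p , q , r }) (λ { (p , q , r) → p , q , r , refl , refl }) (D? i (s i) (s j)) 
      (i Finₚ.<? j ×-dec j Finₚ.<? s i ×-dec s i Finₚ.<? s j))))
    where
    D? = λ i k l → i Finₚ.<? j ×-dec j Finₚ.<? k ×-dec k Finₚ.<? l ×-dec k ≟ s i ×-dec l ≟ s j

  unest-count : ∀ j → unest σ j ≡
    ∑ℕ.∑ (allFin n) (λ i → ι (i Finₚ.<? j ×-dec j Finₚ.<? s j ×-dec s j Finₚ.<? s i))
  unest-count j = ∑ℕ.∑-cong (allFin n) (λ i →
    trans (∑ℕ.∑-cong (allFin n) (λ k → ∑-collapse (D? i k) (s i) (λ { (_ , _ , _ , _ , eq) → eq })))
    (trans (∑-collapse (λ k → D? i k (s i)) (s j) (λ { (_ , _ , _ , eq , _) → eq }))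
    (ι-cong (λ { (p , q , r , _) → p , q , r }) (λ { (p , q , r) → p , q , r , refl , refl }) (D? i (s j) (s i)) 
      (i Finₚ.<? j ×-dec j Finₚ.<? s j ×-dec s j Finₚ.<? s i))))
    where
    D? = λ i k l → i Finₚ.<? j ×-dec j Finₚ.<? k ×-dec k Finₚ.<? l ×-dec k ≟ s j ×-dec l ≟ s i

  lcross-count : ∀ k → lcross σ k ≡
    ∑ℕ.∑ (allFin n) (λ l → ι (k Finₚ.<? l ×-dec s l Finₚ.<? k ×-dec s k Finₚ.<? s l))
  lcross-count k =
    trans (∑ℕ.∑Fin-single (s k) (λ i i≢ → ∑ℕ.∑-ε (allFin n) (λ {j} _ → ∑ℕ.∑-ε (allFin n) (λ {l} _ →
      ι-no (D? i j l) (λ { (_ , _ , _ , eq , _) → i≢ (Finₚ.toℕ-injective eq) })))))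
    (trans (∑ℕ.∑-swap (allFin n) (allFin n) (λ j l → ι (D? (s k) j l)))
    (∑ℕ.∑-cong (allFin n) (λ l →
    trans (∑-collapse (λ j → D? (s k) j l) (s l) (λ { (_ , _ , _ , _ , eq) → eq }))
    (ι-cong (λ { (p , q , r , _) → r , q , p }) (λ { (p , q , r) → r , q , p , refl , refl }) (D? (s k) (s l) l) 
      (k Finₚ.<? l ×-dec s l Finₚ.<? k ×-dec s k Finₚ.<? s l)))))
    where
    D? = λ i j l → i Finₚ.<? j ×-dec j Finₚ.<? k ×-dec k Finₚ.<? l ×-dec i ≟ s k ×-dec j ≟ s l

  lnest-count : ∀ k → lnest σ k ≡
    ∑ℕ.∑ (allFin n) (λ l → ι (k Finₚ.<? l ×-dec s k Finₚ.<? k ×-dec s l Finₚ.<? s k))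
  lnest-count k =
    trans (∑ℕ.∑-cong (allFin n) (λ i → ∑ℕ.∑Fin-single (s k) (λ j j≢ → ∑ℕ.∑-ε (allFin n) (λ {l} _ →
      ι-no (D? i j l) (λ { (_ , _ , _ , _ , eq) → j≢ (Finₚ.toℕ-injective eq) })))))
    (trans (∑ℕ.∑-swap (allFin n) (allFin n) (λ i l → ι (D? i (s k) l)))
    (∑ℕ.∑-cong (allFin n) (λ l →
    trans (∑-collapse (λ i → D? i (s k) l) (s l) (λ { (_ , _ , _ , eq , _) → eq }))
    (ι-cong (λ { (p , q , r , _) → r , q , p }) (λ { (p , q , r) → r , q , p , refl , refl }) (D? (s l) (s k) l) 
      (k Finₚ.<? l ×-dec s k Finₚ.<? k ×-dec s l Finₚ.<? s k)))))
    where
    D? = λ i j l → i Finₚ.<? j ×-dec j Finₚ.<? k ×-dec k Finₚ.<? l ×-dec i ≟ s l ×-dec j ≟ s k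

  psnest-count : ∀ i → psnest σ i ≡ ∑ℕ.∑ (allFin n) (λ j → ι (j Finₚ.<? i ×-dec i Finₚ.<? s j))
  psnest-count i = refl

  iter-+ : ∀ m k x → iter σ (m ℕ.+ k) x ≡ iter σ m (iter σ k x)
  iter-+ zero    k x = refl
  iter-+ (suc m) k x = cong s (iter-+ m k x)

  iter-cancel : ∀ m k x → iter σ m x ≡ iter σ (m ℕ.+ k) x → x ≡ iter σ k x
  iter-cancel zero    k x eq = eq
  iter-cancel (suc m) k x eq = iter-cancel m k x (inj eq)

  -- Among `x` and its first n iterates two coincide, and injectivity cancels their common steps; a
  -- positive period of at most n remains.
  iter-period : ∀ x → ∃ λ p → suc p ≤ n × iter σ (suc p) x ≡ x
  iter-period x with Finₚ.pigeonhole (ℕₚ.n<1+n n) (λ a → iter σ (toℕ a) x)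
  ... | a , b , a<b , eq with ℕₚ.m≤n⇒∃[o]m+o≡n a<b
  ... | d , a+d≡b = d
    , ℕₚ.≤-trans (s≤s (ℕₚ.m≤n+m d (toℕ a))) (subst (_≤ n) (sym a+d≡b) (ℕ.s≤s⁻¹ (Finₚ.toℕ<n b)))
    , sym (iter-cancel (toℕ a) (suc d) x (trans eq (cong (λ m → iter σ m x) (trans (sym a+d≡b) (sym (ℕₚ.+-suc (toℕ a) d))))))

  -- `isCycleMin` tests only n iterates; subtracting the period, which is at most n, brings any
  -- larger `m` down to one of them.
  cycleMin-bound : ∀ {i} → isCycleMin σ i ≡ true → ∀ m → toℕ i ≤ toℕ (iter σ m i)
  cycleMin-bound {i} min m = below m m ℕₚ.≤-refl
    where
    p : ℕ
    p = suc (proj₁ (iter-period i))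
    p≤n : p ≤ n
    p≤n = proj₁ (proj₂ (iter-period i))
    below : ∀ b m → m ≤ b → toℕ i ≤ toℕ (iter σ m i)
    below zero    zero    _   = ℕₚ.≤-refl
    below (suc b) m m≤b with m <? n
    ... | yes m<n = does-true (toℕ i ≤? toℕ (iter σ m i)) (allᵇ-elim min (∈-upTo⁺ m<n))
    ... | no m≮n  = subst (λ x → toℕ i ≤ toℕ x) reduce
      (below b (m ∸ p) (ℕₚ.≤-trans (ℕₚ.∸-mono m≤b (s≤s z≤n)) ℕₚ.≤-refl))
      where
      reduce : iter σ (m ∸ p) i ≡ iter σ m i
      reduce = trans (cong (iter σ (m ∸ p)) (sym (proj₂ (proj₂ (iter-period i)))))
        (trans (sym (iter-+ (m ∸ p) p i)) (cong (λ k → iter σ k i) (ℕₚ.m∸n+n≡m (ℕₚ.≤-trans p≤n (ℕₚ.≮⇒≥ m≮n)))))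

  isCycleMin-true : ∀ {i} → (∀ m → toℕ i ≤ toℕ (iter σ m i)) → isCycleMin σ i ≡ true
  isCycleMin-true {i} min = allᵇ-intro (upTo n) (λ {m} _ → dec-true (toℕ i ≤? toℕ (iter σ m i)) (min m))

  isCycleMin-false : ∀ {i} m → toℕ (iter σ m i) < toℕ i → isCycleMin σ i ≡ false
  isCycleMin-false {i} m less with isCycleMin σ i in min
  ... | true  = contradiction (cycleMin-bound min m) (ℕₚ.<⇒≱ less)
  ... | false = refl

-- The weight of a permutation as a product of local weights

module Weights {ℓ₁ ℓ₂ : Level} (R : CommutativeRing ℓ₁ ℓ₂) where
  open CommutativeRing R renaming (refl to ≈-refl; sym to ≈-sym; trans to ≈-trans)
  open WithRing R
  open SetoidReasoning setoid
  open Sums *-commutativeMonoid renaming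
    (∑ to ∏; ∑-∙ to ∏-*; ∑-cong to ∏-cong; ∑Fin-single to ∏Fin-single) using ()

  when : Bool → Carrier → Carrier
  when b x = if b then x else 1#

  pow-cyc : ∀ {A : Set} x (p : A → Bool) xs → pow x (∑ℕ.∑ xs (λ i → if p i then 1 else 0)) ≈ ∏ xs (λ i → when (p i) x)
  pow-cyc x p []       = ≈-refl
  pow-cyc x p (i ∷ xs) with p i
  ... | true  = *-congˡ (pow-cyc x p xs)
  ... | false = ≈-trans (pow-cyc x p xs) (≈-sym (*-identityˡ _))

  module _ (lam : Carrier) (a : ℕ → Carrier) (b c d : ℕ → ℕ → Carrier) (e : ℕ → Carrier) where

    localWeight : ∀ {n} → Vec (Fin n) n → Fin n → Carrier
    localWeight σ i =
      when (isCycleMin σ i) lam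
      * when (isCval σ i) (a (ucross σ i ℕ.+ unest σ i))
      * when (isCpeak σ i) (b (lcross σ i) (lnest σ i))
      * when (isCdfall σ i) (c (lcross σ i) (lnest σ i))
      * when (isCdrise σ i) (d (ucross σ i) (unest σ i))
      * when (isFix σ i) (e (psnest σ i))

    weight-local : ∀ {n} (σ : Vec (Fin n) n) → weight lam a b c d e σ ≈ ∏ (allFin n) (localWeight σ)
    weight-local {n} σ = ≈-sym (merge (merge (merge (merge (merge (≈-sym (pow-cyc lam (isCycleMin σ) (allFin n))))))))
      where
      merge : {f g : Fin n → Carrier} {x : Carrier} → ∏ (allFin n) f ≈ x →
              ∏ (allFin n) (λ i → f i * g i) ≈ x * ∏ (allFin n) g
      merge {f} {g} eq = ≈-trans (∏-* (allFin n) f g) (*-congʳ eq)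

    -- The part of the weight not yet read off once the values from `k` upwards have been treated.
    weightBelow : ∀ {n} → ℕ → Vec (Fin n) n → Carrier
    weightBelow {n} k σ = ∏ (allFin n) (λ i → when (does (toℕ i <? k)) (localWeight σ i))

    weightBelow-zero : ∀ {n} (σ : Vec (Fin n) n) → weightBelow 0 σ ≈ 1#
    weightBelow-zero {n} σ = Sums.∑-ε *-commutativeMonoid (allFin n) (λ _ → ≈-refl)

    weightBelow-all : ∀ {n} (σ : Vec (Fin n) n) → weight lam a b c d e σ ≈ weightBelow n σ
    weightBelow-all {n} σ = ≈-trans (weight-local σ) (∏-cong (allFin n) (λ i →
      reflexive (cong (λ t → when t (localWeight σ i)) (sym (dec-true (toℕ i <? n) (Finₚ.toℕ<n i))))))

    weightBelow-suc : ∀ {n} (σ : Vec (Fin n) n) (j : Fin n) →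
                     weightBelow (suc (toℕ j)) σ ≈ localWeight σ j * weightBelow (toℕ j) σ
    weightBelow-suc {n} σ j = begin
      weightBelow (suc (toℕ j)) σ
        ≈⟨ ∏-cong (allFin n) split ⟩
      ∏ (allFin n) (λ i → at i * when (does (toℕ i <? toℕ j)) (localWeight σ i))
        ≈⟨ ∏-* (allFin n) _ _ ⟩
      ∏ (allFin n) at * weightBelow (toℕ j) σ
        ≈⟨ *-congʳ (∏Fin-single j (λ i i≢j → reflexive (at-off i≢j))) ⟩
      at j * weightBelow (toℕ j) σ
        ≡⟨ cong (_* weightBelow (toℕ j) σ) (cong (λ t → when t (localWeight σ j)) (dec-true (j Finₚ.≟ j) refl)) ⟩
      localWeight σ j * weightBelow (toℕ j) σ ∎
      where
      at : Fin n → Carrier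
      at i = when (does (i Finₚ.≟ j)) (localWeight σ i)
      at-off : ∀ {i} → i ≢ j → at i ≡ 1#
      at-off {i} i≢j = cong (λ t → when t (localWeight σ i)) (dec-false (i Finₚ.≟ j) i≢j)
      split : ∀ i → when (does (toℕ i <? suc (toℕ j))) (localWeight σ i) ≈
                    at i * when (does (toℕ i <? toℕ j)) (localWeight σ i)
      split i with i Finₚ.≟ j
      ... | yes refl rewrite dec-true (toℕ i <? suc (toℕ i)) ℕₚ.≤-refl | dec-false (toℕ i <? toℕ i) (ℕₚ.<-irrefl refl) =
        ≈-sym (*-identityʳ _)
      ... | no i≢j = ≈-trans (reflexive (cong (λ t → when t (localWeight σ i))
          (does-iff (λ i<1+j → ℕₚ.≤∧≢⇒< (ℕ.s≤s⁻¹ i<1+j) (i≢j ∘ Finₚ.toℕ-injective)) ℕₚ.m<n⇒m<1+n (toℕ i <? suc (toℕ j)) (toℕ i <? toℕ j))))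
        (≈-sym (*-identityˡ _))

-- Partial permutations and their one-step extensions

module _ {a r : Level} {A : Set a} {R : A → A → Set r} where

  allPairs-insert : ∀ xs {x ys} → AllPairs R (xs ++ ys) → All (λ y → R y x) xs → All (R x) ys →
                    AllPairs R (xs ++ x ∷ ys)
  allPairs-insert []       pairs         []         after = after ∷ pairs
  allPairs-insert (z ∷ xs) (Rz ∷ pairs) (Rzx ∷ before) after =
    Allₚ.++⁺ (Allₚ.++⁻ˡ xs Rz) (Rzx ∷ Allₚ.++⁻ʳ xs Rz) ∷ allPairs-insert xs pairs before after

  allPairs-remove : ∀ xs {x ys} → AllPairs R (xs ++ x ∷ ys) →
                    AllPairs R (xs ++ ys) × All (λ y → R y x) xs × All (R x) ys
  allPairs-remove []       (after ∷ pairs) = pairs , [] , after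
  allPairs-remove (z ∷ xs) (Rz ∷ pairs) with allPairs-remove xs pairs | Allₚ.++⁻ʳ xs Rz
  ... | rest , before , after | Rzx ∷ Rzys = Allₚ.++⁺ (Allₚ.++⁻ˡ xs Rz) Rzys ∷ rest , Rzx ∷ before , after

module _ {a : Level} {A : Set a} where

  ∈-insert⁻ : ∀ (xs : List A) {x y ys} → y ∈ xs ++ x ∷ ys → y ≡ x ⊎ y ∈ xs ++ ys
  ∈-insert⁻ xs y∈ with ∈-++⁻ xs y∈
  ... | inj₁ y∈xs         = inj₂ (∈-++⁺ˡ y∈xs)
  ... | inj₂ (here y≡x)   = inj₁ y≡x
  ... | inj₂ (there y∈ys) = inj₂ (∈-++⁺ʳ xs y∈ys)

  ∈-insert⁺ : ∀ (xs : List A) {x y ys} → y ∈ xs ++ ys → y ∈ xs ++ x ∷ ys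
  ∈-insert⁺ xs y∈ with ∈-++⁻ xs y∈
  ... | inj₁ y∈xs = ∈-++⁺ˡ y∈xs
  ... | inj₂ y∈ys = ∈-++⁺ʳ xs (there y∈ys)

module _ {n : ℕ} where

  transpose-left : (i j : Fin n) → transpose i j i ≡ j
  transpose-left i j rewrite dec-true (i Finₚ.≟ i) refl = refl

  transpose-right : (i j : Fin n) → transpose i j j ≡ i
  transpose-right i j with j Finₚ.≟ i
  ... | yes refl = refl
  ... | no _ rewrite dec-true (j Finₚ.≟ j) refl = refl

  transpose-other : {i j k : Fin n} → k ≢ i → k ≢ j → transpose i j k ≡ k
  transpose-other {i} {j} {k} k≢i k≢j
    rewrite dec-false (k Finₚ.≟ i) k≢i | dec-false (k Finₚ.≟ j) k≢j = refl

  transpose-injection : (i j : Fin n) → Injection (transpose i j)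
  transpose-injection i j eq =
    trans (sym (transpose-inverse j i)) (trans (cong (transpose j i) eq) (transpose-inverse j i))

  open DecMembership (Finₚ._≟_ {n}) using (_∈?_)

  -- The partial permutation built from the values at least k is stored as ρ, in which
  -- each of its open paths is closed up to a cycle: an end l of an open path, whose
  -- image is still to come, lies in L and ρ l is the start of that path. L lists the
  -- ends by decreasing image.
  record Compat (k : ℕ) (ρ : Fin n → Fin n) (L : List (Fin n)) (s : Fin n → Fin n) : Set where
    constructor compat
    field
      agree : ∀ i → k ≤ toℕ i → i ∉ L → s i ≡ ρ i
      low   : All (λ l → toℕ (s l) < k) L
      decr  : AllPairs (λ l l′ → toℕ (s l′) < toℕ (s l)) L

  compat? : ∀ k ρ L s → Dec (Compat k ρ L s)
  compat? k ρ L s = map′ (λ { (p , q , r) → compat p q r }) (λ { (compat p q r) → p , q , r })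
    (Finₚ.all? (λ i → (k ≤? toℕ i) →-dec (¬? (i ∈? L) →-dec (s i Finₚ.≟ ρ i)))
     ×-dec All.all? (λ l → toℕ (s l) <? k) L
     ×-dec AllPairs.allPairs? (λ l l′ → toℕ (s l′) <? toℕ (s l)) L)

  -- Every step leaves from a point outside `L`; at such points, from `k` upwards, a compatible
  -- permutation agrees with ρ, so the path is a piece of its orbit too.
  data Path (ρ : Fin n → Fin n) (L : List (Fin n)) : Fin n → Fin n → Set where
    []  : ∀ {x} → Path ρ L x x
    _∷_ : ∀ {x y} → x ∉ L → Path ρ L (ρ x) y → Path ρ L x y

  -- `L-path` says that the cycle of ρ through an end meets no other end, so ends correspond to open
  -- paths; this is what decides whether a new arrow closes a cycle. By `ρ-fixes`, an untreated
  -- value is inserted into a cycle by a mere transposition.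
  record Inv (k : ℕ) (ρ : Fin n → Fin n) (L : List (Fin n)) : Set where
    field
      ρ-inj   : Injection ρ
      ρ-fixes : ∀ i → toℕ i < k → ρ i ≡ i
      L-high  : All (λ l → k ≤ toℕ l) L
      L-uniq  : Unique L
      L-path  : ∀ {l} → l ∈ L → Path ρ L (ρ l) l

    -- A value below `k` is already the image of itself, and ρ is injective.
    ρ-high : ∀ {i} → k ≤ toℕ i → k ≤ toℕ (ρ i)
    ρ-high {i} k≤i with k ≤? toℕ (ρ i)
    ... | yes k≤ρi = k≤ρi
    ... | no k≰ρi  = contradiction (subst (λ x → toℕ x < k) (ρ-inj (ρ-fixes (ρ i) (ℕₚ.≰⇒> k≰ρi))) (ℕₚ.≰⇒> k≰ρi)) (ℕₚ.≤⇒≯ k≤i)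

  -- How j is attached to a state whose list of ends is L, by the type of j.  peak (xs , ys)
  -- and dfall l (xs , ys) rank the image of j below those of xs and above those of ys;
  -- drise l′ and val l R l′ send j to ρ l′; dfall l and val l R send l to j, which forces
  -- l to be the head of L (with tail R) because its image is then the largest.
  data Choice : Set where
    fix   : Choice
    peak  : List (Fin n) × List (Fin n) → Choice
    drise : Fin n → Choice
    dfall : Fin n → List (Fin n) × List (Fin n) → Choice
    val   : Fin n → List (Fin n) → Fin n → Choice

  closings : List (Fin n) → List Choice
  closings []      = []
  closings (l ∷ R) = map (dfall l) (splits R) ++ map (val l R) (l ∷ R)

  choices : List (Fin n) → List Choice
  choices L = fix ∷ map peak (splits L) ++ (map drise L ++ closings L)

  data Allowed : Choice → List (Fin n) → Set where
    fix   : ∀ {L} → Allowed fix L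
    peak  : ∀ xs ys → Allowed (peak (xs , ys)) (xs ++ ys)
    drise : ∀ {L l′} → l′ ∈ L → Allowed (drise l′) L
    dfall : ∀ {l} xs ys → Allowed (dfall l (xs , ys)) (l ∷ xs ++ ys)
    val   : ∀ {l R l′} → l′ ∈ l ∷ R → Allowed (val l R l′) (l ∷ R)

  module _ (j : Fin n) where

    -- In the case val l R l, transpose l l is the identity and a cycle through j is completed.
    nextρ : Choice → (Fin n → Fin n) → Fin n → Fin n
    nextρ fix          ρ = ρ
    nextρ (peak _)     ρ = ρ
    nextρ (drise l′)   ρ = ρ ∘ transpose j l′
    nextρ (dfall l _)  ρ = ρ ∘ transpose j l
    nextρ (val l _ l′) ρ = ρ ∘ transpose l l′ ∘ transpose j l

    -- `drise` and `dfall` insert `j` into a cycle of ρ in the same way, and only the list tells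
    -- them apart: in the first the arrow leaving `j` is final and the end stays, in the second the
    -- arrow into `j` is final and `j` becomes the end.
    nextL : Choice → List (Fin n) → List (Fin n)
    nextL fix                L = L
    nextL (peak (xs , ys))    L = xs ++ j ∷ ys
    nextL (drise _)           L = L
    nextL (dfall _ (xs , ys)) L = xs ++ j ∷ ys
    nextL (val _ R _)         L = R

    -- The clauses `s l ≢ j` express that the preimage of `j` is smaller than `j`: a larger preimage
    -- would have to be an end.
    Cond : (ρ : Fin n → Fin n) (L : List (Fin n)) (s : Fin n → Fin n) → Choice → Set
    Cond ρ L s fix          = s j ≡ j
    Cond ρ L s (peak sp)    = toℕ (s j) < toℕ j × All (λ l → s l ≢ j) L × Separates (toℕ ∘ s) (toℕ (s j)) sp
    Cond ρ L s (drise l′)   = s j ≡ ρ l′ × All (λ l → s l ≢ j) L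
    Cond ρ L s (dfall l sp) = s l ≡ j × toℕ (s j) < toℕ j × Separates (toℕ ∘ s) (toℕ (s j)) sp
    Cond ρ L s (val l R l′) = s l ≡ j × s j ≡ ρ l′

    module _ {ρ : Fin n → Fin n} {L : List (Fin n)} (inv : Inv (suc (toℕ j)) ρ L) where
      open Inv inv

      ρj≡j : ρ j ≡ j
      ρj≡j = ρ-fixes j ℕₚ.≤-refl

      above⇒≢ : ∀ {i : Fin n} → toℕ j < toℕ i → i ≢ j
      above⇒≢ j<i refl = ℕₚ.<-irrefl refl j<i

      ≢⇒above : ∀ {i : Fin n} → toℕ j ≤ toℕ i → i ≢ j → toℕ j < toℕ i
      ≢⇒above j≤i i≢j = ℕₚ.≤∧≢⇒< j≤i (i≢j ∘ sym ∘ Finₚ.toℕ-injective)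

      ≢⇒below : ∀ {i : Fin n} → toℕ i < suc (toℕ j) → i ≢ j → toℕ i < toℕ j
      ≢⇒below i≤j i≢j = ℕₚ.≤∧≢⇒< (ℕ.s≤s⁻¹ i≤j) (i≢j ∘ Finₚ.toℕ-injective)

      below⇒≢ : ∀ {i : Fin n} → toℕ i < toℕ j → i ≢ j
      below⇒≢ i<j refl = ℕₚ.<-irrefl refl i<j

      L≢j : ∀ {l} → l ∈ L → l ≢ j
      L≢j l∈ = above⇒≢ (All.lookup L-high l∈)

      j∉L : j ∉ L
      j∉L j∈ = L≢j j∈ refl

      L∉ : ∀ {i l} → i ∉ L → l ∈ L → i ≢ l
      L∉ i∉ l∈ refl = i∉ l∈

-- Completions of a state and of its extensions

module _ {n : ℕ} (j : Fin n) {ρ s : Fin n → Fin n} (s-inj : Injection s) where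

  private
    k : ℕ
    k = toℕ j

  -- Together with `compat-next⁺`: the completions of the new state are the completions of the old
  -- one that satisfy `Cond`. In the closing cases `l` returns to the head of the list, since its
  -- image `j` exceeds the images of all remaining ends.
  compat-next⁻ : ∀ {c L} → Inv (suc k) ρ L → Allowed c L → Compat k (nextρ j c ρ) (nextL j c L) s →
                 Compat (suc k) ρ L s × Cond j ρ L s c
  compat-next⁻ inv fix (compat agree low decr) =
      compat (λ i k<i → agree i (ℕₚ.<⇒≤ k<i)) (All.map ℕₚ.m<n⇒m<1+n low) decr
    , trans (agree j ℕₚ.≤-refl (j∉L j inv)) (ρj≡j j inv)
  compat-next⁻ inv (peak xs ys) (compat agree low decr) with allPairs-remove xs decr
  ... | decr′ , before , after =
      compat (λ i k<i i∉ → agree i (ℕₚ.<⇒≤ k<i) ([ above⇒≢ j inv k<i , i∉ ]′ ∘ ∈-insert⁻ xs))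
             (All.map ℕₚ.m<n⇒m<1+n low′) decr′
    , All.lookup low (∈-insert xs) , All.map (below⇒≢ j inv) low′ , before , after
    where low′ = All.tabulate (λ l∈ → All.lookup low (∈-insert⁺ xs l∈))
  compat-next⁻ inv (drise l′∈) (compat agree low decr) =
      compat (λ i k<i i∉ → trans (agree i (ℕₚ.<⇒≤ k<i) i∉)
                (cong ρ (transpose-other (above⇒≢ j inv k<i) (L∉ j inv i∉ l′∈))))
             (All.map ℕₚ.m<n⇒m<1+n low) decr
    , trans (agree j ℕₚ.≤-refl (j∉L j inv)) (cong ρ (transpose-left j _)) , All.map (below⇒≢ j inv) low
  compat-next⁻ inv (dfall {l} xs ys) (compat agree low decr)
    with allPairs-remove xs decr | Inv.L-uniq inv
  ... | decr′ , before , after | l∉ ∷ _ =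
      compat (λ i k<i i∉ → trans (agree i (ℕₚ.<⇒≤ k<i) ([ above⇒≢ j inv k<i , i∉ ∘ there ]′ ∘ ∈-insert⁻ xs))
                (cong ρ (transpose-other (above⇒≢ j inv k<i) (i∉ ∘ here))))
             (ℕₚ.≤-reflexive (cong (suc ∘ toℕ) sl≡j) ∷ All.map ℕₚ.m<n⇒m<1+n low′)
             (All.map (λ sx<k → subst (λ x → _ < toℕ x) (sym sl≡j) sx<k) low′ ∷ decr′)
    , sl≡j , All.lookup low (∈-insert xs) , before , after
    where
    low′ = All.tabulate (λ l∈ → All.lookup low (∈-insert⁺ xs l∈))
    sl≡j : s l ≡ j
    sl≡j = trans
      (agree l (ℕₚ.<⇒≤ (All.head (Inv.L-high inv)))
        ([ L≢j j inv (here refl) , (λ l∈ → All.lookup l∉ l∈ refl) ]′ ∘ ∈-insert⁻ xs))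
      (trans (cong ρ (transpose-right j l)) (ρj≡j j inv))
  compat-next⁻ inv (val {l} {R} {l′} l′∈) (compat agree low decr) with Inv.L-uniq inv
  ... | l∉ ∷ _ =
      compat (λ i k<i i∉ → trans (agree i (ℕₚ.<⇒≤ k<i) (i∉ ∘ there))
                (cong ρ (trans (cong (transpose l l′) (transpose-other (above⇒≢ j inv k<i) (i∉ ∘ here)))
                               (transpose-other (i∉ ∘ here) (L∉ j inv i∉ l′∈)))))
             (ℕₚ.≤-reflexive (cong (suc ∘ toℕ) sl≡j) ∷ All.map ℕₚ.m<n⇒m<1+n low)
             (All.map (λ sx<k → subst (λ x → _ < toℕ x) (sym sl≡j) sx<k) low ∷ decr)
    , sl≡j
    , trans (agree j ℕₚ.≤-refl (j∉L j inv ∘ there))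
            (cong ρ (trans (cong (transpose l l′) (transpose-left j l)) (transpose-left l l′)))
    where
    sl≡j : s l ≡ j
    sl≡j = trans
      (agree l (ℕₚ.<⇒≤ (All.head (Inv.L-high inv))) (λ l∈ → All.lookup l∉ l∈ refl))
      (trans (cong ρ (trans (cong (transpose l l′) (transpose-right j l))
                            (transpose-other (L≢j j inv (here refl) ∘ sym) (L≢j j inv l′∈ ∘ sym))))
             (ρj≡j j inv))

  compat-next⁺ : ∀ {c L} → Inv (suc k) ρ L → Allowed c L → Compat (suc k) ρ L s → Cond j ρ L s c →
                 Compat k (nextρ j c ρ) (nextL j c L) s
  compat-next⁺ {L = L} inv fix (compat agree low decr) sj≡j = compat agree′ low′ decr
    where
    agree′ : ∀ i → k ≤ toℕ i → i ∉ L → s i ≡ ρ i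
    agree′ i k≤i i∉ with i Finₚ.≟ j
    ... | yes refl = trans sj≡j (sym (ρj≡j j inv))
    ... | no i≢j   = agree i (≢⇒above j inv k≤i i≢j) i∉
    low′ : All (λ l → toℕ (s l) < k) L
    low′ = All.tabulate (λ l∈ → ≢⇒below j inv (All.lookup low l∈)
      (λ sl≡j → L≢j j inv l∈ (s-inj (trans sl≡j (sym sj≡j)))))
  compat-next⁺ inv (peak xs ys) (compat agree low decr) (sj<j , sl≢j , before , after) =
    compat (λ i k≤i i∉ → agree i (≢⇒above j inv k≤i (λ { refl → i∉ (∈-insert xs) })) (i∉ ∘ ∈-insert⁺ xs))
           (All.tabulate (λ l∈ → [ (λ { refl → sj<j }) , (λ l∈ → ≢⇒below j inv (All.lookup low l∈) (All.lookup sl≢j l∈)) ]′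
                                    (∈-insert⁻ xs l∈)))
           (allPairs-insert xs decr before after)
  compat-next⁺ {drise l′} {L} inv (drise l′∈) (compat agree low decr) (sj≡ , sl≢j) = compat agree′
      (All.zipWith (λ { (sl≤j , sl≢j) → ≢⇒below j inv sl≤j sl≢j }) (low , sl≢j)) decr
    where
    agree′ : ∀ i → k ≤ toℕ i → i ∉ L → s i ≡ ρ (transpose j l′ i)
    agree′ i k≤i i∉ with i Finₚ.≟ j
    ... | yes refl = sj≡
    ... | no i≢j rewrite dec-false (i Finₚ.≟ l′) (L∉ j inv i∉ l′∈) = agree i (≢⇒above j inv k≤i i≢j) i∉
  compat-next⁺ {dfall l _} inv (dfall xs ys) (compat agree low (sx<sl ∷ decr)) (sl≡j , sj<j , before , after) =
      compat agree′
        (All.tabulate (λ l∈ → [ (λ { refl → sj<j }) , (λ l∈ → subst (λ x → _ < toℕ x) sl≡j (All.lookup sx<sl l∈)) ]′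
                                    (∈-insert⁻ xs l∈)))
        (allPairs-insert xs decr before after)
    where
    agree′ : ∀ i → k ≤ toℕ i → i ∉ xs ++ j ∷ ys → s i ≡ ρ (transpose j l i)
    agree′ i k≤i i∉ with i Finₚ.≟ j
    ... | yes refl = contradiction (∈-insert xs) i∉
    ... | no i≢j with i Finₚ.≟ l
    ...   | yes refl = trans sl≡j (sym (ρj≡j j inv))
    ...   | no i≢l   = agree i (≢⇒above j inv k≤i i≢j) λ { (here i≡l) → i≢l i≡l ; (there i∈) → i∉ (∈-insert⁺ xs i∈) }
  compat-next⁺ {val l R l′} inv (val l′∈) (compat agree low (sx<sl ∷ decr)) (sl≡j , sj≡) =
      compat agree′ (All.map (subst (λ x → _ < toℕ x) sl≡j) sx<sl) decr
    where
    agree′ : ∀ i → k ≤ toℕ i → i ∉ R → s i ≡ ρ (transpose l l′ (transpose j l i))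
    agree′ i k≤i i∉ with i Finₚ.≟ j
    ... | yes refl = trans sj≡ (cong ρ (sym (transpose-left l l′)))
    ... | no i≢j with i Finₚ.≟ l
    ...   | yes refl = trans sl≡j (sym (trans
              (cong ρ (transpose-other (L≢j j inv (here refl) ∘ sym) (L≢j j inv l′∈ ∘ sym))) (ρj≡j j inv)))
    ...   | no i≢l   = trans (agree i (≢⇒above j inv k≤i i≢j) i∉L) (cong ρ (sym (transpose-other i≢l (L∉ j inv i∉L l′∈))))
      where
      i∉L : i ∉ l ∷ R
      i∉L (here i≡l)  = i≢l i≡l
      i∉L (there i∈R) = i∉ i∈R

-- Extensions preserve the invariants

module _ {n : ℕ} where

  choices-allowed : ∀ L {c} → c ∈ choices {n} L → Allowed c L
  choices-allowed L (here refl) = fix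
  choices-allowed L (there c∈) with ∈-++⁻ (map peak (splits L)) c∈
  ... | inj₁ c∈peaks with ∈-map⁻ peak c∈peaks
  ...   | (xs , ys) , sp∈ , refl = subst (Allowed _) (splits-++ L sp∈) (peak xs ys)
  choices-allowed L (there c∈) | inj₂ c∈rest with ∈-++⁻ (map drise L) c∈rest
  ... | inj₁ c∈drises with ∈-map⁻ drise c∈drises
  ...   | _ , l′∈ , refl = drise l′∈
  choices-allowed (l ∷ R) (there c∈) | inj₂ c∈rest | inj₂ c∈closings
    with ∈-++⁻ (map (dfall l) (splits R)) c∈closings
  ... | inj₁ c∈dfalls with ∈-map⁻ (dfall l) c∈dfalls
  ...   | (xs , ys) , sp∈ , refl = subst (Allowed _) (cong (l ∷_) (splits-++ R sp∈)) (dfall xs ys)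
  choices-allowed (l ∷ R) (there c∈) | inj₂ c∈rest | inj₂ c∈closings | inj₂ c∈vals with ∈-map⁻ (val l R) c∈vals
  ...   | _ , l′∈ , refl = val l′∈

  -- A path that starts away from the fixed point `j` cannot run into it, because ρ is injective; so
  -- changing ρ and `L` only at `j` and at old ends leaves the path intact.
  path-map : ∀ {j : Fin n} {ρ ρ′ : Fin n → Fin n} {L L′ x y} → Injection ρ → ρ j ≡ j →
             (∀ {z} → z ∉ L → z ≢ j → z ∉ L′ × ρ′ z ≡ ρ z) →
             x ≢ j → Path ρ L x y → Path ρ′ L′ x y
  path-map ρ-inj ρj≡j same x≢j [] = []
  path-map {ρ′ = ρ′} {L′ = L′} {y = y} ρ-inj ρj≡j same x≢j (x∉ ∷ p) with same x∉ x≢j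
  ... | x∉′ , ρ′x≡ρx = x∉′ ∷ subst (λ z → Path ρ′ L′ z y) (sym ρ′x≡ρx)
    (path-map ρ-inj ρj≡j same (λ ρx≡j → x≢j (ρ-inj (trans ρx≡j (sym ρj≡j)))) p)

  path-++ : ∀ {ρ : Fin n → Fin n} {L x y z} → Path ρ L x y → Path ρ L y z → Path ρ L x z
  path-++ []       q = q
  path-++ (x∉ ∷ p) q = x∉ ∷ path-++ p q

module _ {n : ℕ} (j : Fin n) {ρ : Fin n → Fin n} where

  private
    k : ℕ
    k = toℕ j

  inv-next : ∀ {c L} → Allowed c L → Inv (suc k) ρ L → Inv k (nextρ j c ρ) (nextL j c L)
  inv-next fix inv = record
    { ρ-inj = ρ-inj ; ρ-fixes = λ i i<k → ρ-fixes i (ℕₚ.m<n⇒m<1+n i<k)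
    ; L-high = All.map ℕₚ.<⇒≤ L-high ; L-uniq = L-uniq ; L-path = L-path }
    where open Inv inv
  inv-next (peak xs ys) inv = record
    { ρ-inj = ρ-inj ; ρ-fixes = λ i i<k → ρ-fixes i (ℕₚ.m<n⇒m<1+n i<k)
    ; L-high = All.tabulate (λ l∈ → [ (λ { refl → ℕₚ.≤-refl }) , (λ l∈ → ℕₚ.<⇒≤ (All.lookup L-high l∈)) ]′ (∈-insert⁻ xs l∈))
    ; L-uniq = allPairs-insert xs L-uniq (Allₚ.++⁻ˡ xs ≢j) (All.map (_∘ sym) (Allₚ.++⁻ʳ xs ≢j))
    ; L-path = λ l∈ → [ (λ { refl → subst (λ x → Path ρ _ x j) (sym (ρj≡j j inv)) [] })
                       , (λ l∈ → path-map ρ-inj (ρj≡j j inv) (λ z∉ z≢j → [ z≢j , z∉ ]′ ∘ ∈-insert⁻ xs , refl)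
                                   (above⇒≢ j inv (ρ-high (All.lookup L-high l∈))) (L-path l∈)) ]′ (∈-insert⁻ xs l∈) }
    where
    open Inv inv
    ≢j : All (_≢ j) (xs ++ ys)
    ≢j = All.tabulate (L≢j j inv)
  inv-next {drise l′} {L} (drise l′∈) inv = record
    { ρ-inj = transpose-injection j l′ ∘ ρ-inj
    ; ρ-fixes = λ i i<k → trans
        (cong ρ (transpose-other (below⇒≢ j inv i<k)
                  (λ { refl → ℕₚ.<-asym i<k (All.lookup L-high l′∈) })))
        (ρ-fixes i (ℕₚ.m<n⇒m<1+n i<k))
    ; L-high = All.map ℕₚ.<⇒≤ L-high ; L-uniq = L-uniq ; L-path = path }
    where
    open Inv inv
    old : ∀ {l} → l ∈ L → Path (ρ ∘ transpose j l′) L (ρ l) l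
    old l∈ = path-map ρ-inj (ρj≡j j inv)
      (λ z∉ z≢j → z∉ , cong ρ (transpose-other z≢j (L∉ j inv z∉ l′∈)))
      (above⇒≢ j inv (ρ-high (All.lookup L-high l∈))) (L-path l∈)
    path : ∀ {l} → l ∈ L → Path (ρ ∘ transpose j l′) L (ρ (transpose j l′ l)) l
    path {l} l∈ with l Finₚ.≟ l′
    ... | no l≢l′  = subst (λ x → Path (ρ ∘ transpose j l′) L (ρ x) l) (sym (transpose-other (L≢j j inv l∈) l≢l′)) (old l∈)
    -- The path with end `l′` now starts at `j` and continues as before.
    ... | yes refl = subst (λ x → Path (ρ ∘ transpose j l′) L x l) (sym (trans (cong ρ (transpose-right j l)) (ρj≡j j inv)))
      (j∉L j inv ∷ subst (λ x → Path (ρ ∘ transpose j l′) L (ρ x) l) (sym (transpose-left j l)) (old l∈))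
  inv-next {dfall l _} (dfall xs ys) inv with Inv.L-uniq inv
  ... | l∉ ∷ R-uniq = record
    { ρ-inj = transpose-injection j l ∘ ρ-inj
    ; ρ-fixes = λ i i<k → trans
        (cong ρ (transpose-other (below⇒≢ j inv i<k)
                  (λ { refl → ℕₚ.<-asym i<k (All.head L-high) })))
        (ρ-fixes i (ℕₚ.m<n⇒m<1+n i<k))
    ; L-high = All.tabulate (λ l∈ → [ (λ { refl → ℕₚ.≤-refl }) , (λ l∈ → ℕₚ.<⇒≤ (All.lookup (All.tail L-high) l∈)) ]′ (∈-insert⁻ xs l∈))
    ; L-uniq = allPairs-insert xs R-uniq (Allₚ.++⁻ˡ xs ≢j) (All.map (_∘ sym) (Allₚ.++⁻ʳ xs ≢j))
    ; L-path = path }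
    where
    open Inv inv
    ≢j : All (_≢ j) (xs ++ ys)
    ≢j = All.tabulate (L≢j j inv ∘ there)
    same : ∀ {z} → z ∉ l ∷ xs ++ ys → z ≢ j → z ∉ xs ++ j ∷ ys × ρ (transpose j l z) ≡ ρ z
    same z∉ z≢j = [ z≢j , z∉ ∘ there ]′ ∘ ∈-insert⁻ xs , cong ρ (transpose-other z≢j (z∉ ∘ here))
    old : ∀ {x} → x ∈ l ∷ xs ++ ys → Path (ρ ∘ transpose j l) (xs ++ j ∷ ys) (ρ x) x
    old x∈ = path-map ρ-inj (ρj≡j j inv) same (above⇒≢ j inv (ρ-high (All.lookup L-high x∈))) (L-path x∈)
    path : ∀ {x} → x ∈ xs ++ j ∷ ys → Path (ρ ∘ transpose j l) (xs ++ j ∷ ys) (ρ (transpose j l x)) x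
    path {x} x∈ with ∈-insert⁻ xs x∈
    ... | inj₂ x∈R = subst (λ z → Path (ρ ∘ transpose j l) (xs ++ j ∷ ys) (ρ z) x)
      (sym (transpose-other (L≢j j inv (there x∈R)) (λ { refl → All.lookup l∉ x∈R refl }))) (old (there x∈R))
    -- The path of the new end `j` is the old path of `l` followed by the arrow from `l` to `j`.
    ... | inj₁ refl = subst (λ z → Path (ρ ∘ transpose j l) (xs ++ j ∷ ys) (ρ z) j) (sym (transpose-left j l))
      (path-++ (old (here refl))
        (([ L≢j j inv (here refl) , (λ l∈ → All.lookup l∉ l∈ refl) ]′ ∘ ∈-insert⁻ xs)
          ∷ subst (λ z → Path (ρ ∘ transpose j l) (xs ++ j ∷ ys) z j) (sym (trans (cong ρ (transpose-right j l)) (ρj≡j j inv))) []))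
  inv-next {val l R l′} (val l′∈) inv with Inv.L-uniq inv
  ... | l∉ ∷ R-uniq = record
    { ρ-inj = transpose-injection j l ∘ transpose-injection l l′ ∘ ρ-inj
    ; ρ-fixes = λ i i<k → trans
        (cong ρ (trans (cong (transpose l l′) (transpose-other (below⇒≢ j inv i<k) (low i<k (here refl))))
                       (transpose-other (low i<k (here refl)) (low i<k l′∈))))
        (ρ-fixes i (ℕₚ.m<n⇒m<1+n i<k))
    ; L-high = All.map ℕₚ.<⇒≤ (All.tail L-high) ; L-uniq = R-uniq ; L-path = path }
    where
    open Inv inv
    ρ′ : Fin n → Fin n
    ρ′ = ρ ∘ transpose l l′ ∘ transpose j l
    low : ∀ {i x} → toℕ i < k → x ∈ l ∷ R → i ≢ x
    low i<k x∈ refl = ℕₚ.<-asym i<k (All.lookup L-high x∈)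
    l≢ : ∀ {x} → x ∈ R → x ≢ l
    l≢ x∈ refl = All.lookup l∉ x∈ refl
    ρ′-other : ∀ {z} → z ≢ j → z ≢ l → z ≢ l′ → ρ′ z ≡ ρ z
    ρ′-other z≢j z≢l z≢l′ =
      cong ρ (trans (cong (transpose l l′) (transpose-other z≢j z≢l)) (transpose-other z≢l z≢l′))
    old : ∀ {x} → x ∈ l ∷ R → Path ρ′ R (ρ x) x
    old x∈ = path-map ρ-inj (ρj≡j j inv) (λ z∉ z≢j → z∉ ∘ there , ρ′-other z≢j (z∉ ∘ here) (L∉ j inv z∉ l′∈))
      (above⇒≢ j inv (ρ-high (All.lookup L-high x∈))) (L-path x∈)
    path : ∀ {x} → x ∈ R → Path ρ′ R (ρ′ x) x
    path {x} x∈ with x Finₚ.≟ l′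
    ... | no x≢l′  = subst (λ z → Path ρ′ R z x) (sym (ρ′-other (L≢j j inv (there x∈)) (l≢ x∈) x≢l′)) (old (there x∈))
    -- Two paths merge: the one ending in `l` is run through first, then the arrows from `l` to `j`
    -- and from `j` to the old start `ρ x`, then the old path of `x`.
    ... | yes refl = subst (λ z → Path ρ′ R z x) (sym ρ′x≡)
      (path-++ (old (here refl)) ((λ l∈ → All.lookup l∉ l∈ refl) ∷ subst (λ z → Path ρ′ R z x) (sym ρ′l≡)
        ((j∉L j inv ∘ there) ∷ subst (λ z → Path ρ′ R z x) (sym ρ′j≡) (old (there x∈)))))
      where
      ρ′x≡ : ρ′ x ≡ ρ l
      ρ′x≡ = cong ρ (trans (cong (transpose l x) (transpose-other (L≢j j inv (there x∈)) (l≢ x∈))) (transpose-right l x))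
      ρ′l≡ : ρ′ l ≡ j
      ρ′l≡ = trans (cong ρ (trans (cong (transpose l x) (transpose-right j l))
        (transpose-other (L≢j j inv (here refl) ∘ sym) (L≢j j inv (there x∈) ∘ sym)))) (ρj≡j j inv)
      ρ′j≡ : ρ′ j ≡ ρ x
      ρ′j≡ = cong ρ (trans (cong (transpose l x) (transpose-left j l)) (transpose-left l x))

-- The choice made by a given permutation

module _ {n : ℕ} (j : Fin n) {ρ s : Fin n → Fin n} (s-inj : Injection s) where

  private
    k : ℕ
    k = toℕ j

  -- Suppose `i` lies above `k`. Outside `L` it would satisfy s i = ρ i = ρ l, so `i` would be the
  -- end `l`; and the image of an end is at most `k`, whereas `ρ l` is above it.
  open-start⇒source≤ : ∀ {L i l} → Inv (suc k) ρ L → Compat (suc k) ρ L s → l ∈ L → s i ≡ ρ l → toℕ i ≤ k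
  open-start⇒source≤ {L} {i} {l} inv (compat agree low decr) l∈ si≡ρl with toℕ i ≤? k
  ... | yes i≤k = i≤k
  ... | no i≰k  = contradiction (Inv.ρ-high inv (All.lookup (Inv.L-high inv) l∈))
    (λ k<ρl → ℕₚ.<⇒≱ (All.lookup low i∈) (subst (λ x → suc k ≤ toℕ x) (sym si≡ρl) k<ρl))
    where
    open DecMembership (Finₚ._≟_ {n}) using (_∈?_)
    i∈ : i ∈ L
    i∈ with i ∈? L
    ... | yes i∈ = i∈
    ... | no i∉  = subst (_∈ L) (sym (Inv.ρ-inj inv (trans (sym (agree i (ℕₚ.≰⇒> i≰k) i∉)) si≡ρl))) l∈

  -- The preimage `y` of `s i` under ρ lies above `k`; outside `L` it would also be the preimage
  -- under `s`, hence equal to `i`.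
  upper-image⇒open-start : ∀ {L i} → Inv (suc k) ρ L → Compat (suc k) ρ L s → toℕ i ≤ k → k < toℕ (s i) →
                           ∃ λ l → l ∈ L × s i ≡ ρ l
  upper-image⇒open-start {L} {i} inv (compat agree low decr) i≤k k<si
    with injection-surjective (Inv.ρ-inj inv) (s i)
  ... | y , ρy≡si = y , y∈ , sym ρy≡si
    where
    open DecMembership (Finₚ._≟_ {n}) using (_∈?_)
    k<y : k < toℕ y
    k<y with k <? toℕ y
    ... | yes k<y = k<y
    ... | no k≮y  = contradiction k<si (λ k<si → k≮y (subst (λ x → k < toℕ x)
      (trans (sym ρy≡si) (Inv.ρ-fixes inv y (s≤s (ℕₚ.≮⇒≥ k≮y)))) k<si))
    y∈ : y ∈ L
    y∈ with y ∈? L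
    ... | yes y∈ = y∈
    ... | no y∉  = contradiction (subst (λ x → toℕ x ≤ k) (sym (s-inj (trans (agree y k<y y∉) ρy≡si))) i≤k) (ℕₚ.<⇒≱ k<y)

  -- The type is settled by comparing σ(j) with j and by asking whether the head of `L` is sent to
  -- `j`: the images of ends are at most `j` and decrease, so no later end can be sent there. Within
  -- the type, the rank or the start is then determined.
  one-choice : ∀ {L} → Inv (suc k) ρ L → Compat (suc k) ρ L s → ExactlyOne (Cond j ρ L s) (choices L)
  one-choice {L} inv comp@(compat agree low decr) with ℕₚ.<-cmp (toℕ (s j)) k
  ... | tri≈ _ sj≡k _ = here sj≡j
    (Allₚ.++⁺ (Allₚ.map⁺ (All.universal (λ { _ (sj<j , _) → ℕₚ.<-irrefl sj≡k sj<j }) (splits L)))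
    (Allₚ.++⁺ (Allₚ.map⁺ (All.tabulate (λ { l′∈ (sj≡ , _) →
        ℕₚ.<-irrefl refl (subst (k <_) (trans (cong toℕ (sym sj≡)) sj≡k) (Inv.ρ-high inv (All.lookup (Inv.L-high inv) l′∈))) })))
      (none L inv)))
    where
    sj≡j : s j ≡ j
    sj≡j = Finₚ.toℕ-injective sj≡k
    sl≢j : ∀ {L l} → Inv (suc k) ρ L → l ∈ L → s l ≢ j
    sl≢j inv l∈ sl≡j = L≢j j inv l∈ (s-inj (trans sl≡j (sym sj≡j)))
    none : ∀ L → Inv (suc k) ρ L → All (¬_ ∘ Cond j ρ L s) (closings L)
    none []      inv = []
    none (l ∷ R) inv = Allₚ.++⁺
      (Allₚ.map⁺ (All.universal (λ { _ (sl≡j , _) → sl≢j inv (here refl) sl≡j }) (splits R)))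
      (Allₚ.map⁺ (All.universal (λ { _ (sl≡j , _) → sl≢j inv (here refl) sl≡j }) (l ∷ R)))
  ... | tri< sj<j sj≢k _ = there (λ sj≡j → sj≢k (cong toℕ sj≡j)) (falls L inv comp)
    where
    none-drise : ∀ L → Inv (suc k) ρ L → All (¬_ ∘ Cond j ρ L s) (map drise L)
    none-drise L inv = Allₚ.map⁺ (All.tabulate (λ { l′∈ (sj≡ , _) →
      ℕₚ.<-asym sj<j (subst (λ x → k < toℕ x) (sym sj≡) (Inv.ρ-high inv (All.lookup (Inv.L-high inv) l′∈))) }))
    peaks : ∀ {L} → Inv (suc k) ρ L → Compat (suc k) ρ L s → All (λ l → s l ≢ j) L →
            ExactlyOne (Cond j ρ L s) (map peak (splits L))
    peaks inv (compat agree low decr) sl≢j = ExactlyOneₚ.map⁺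
      (λ _ sep → sj<j , sl≢j , sep) (λ { _ (_ , _ , sep) → sep })
      (one-split-separates (toℕ ∘ s) decr (All.tabulate (λ l∈ eq → L≢j j inv l∈ (s-inj (Finₚ.toℕ-injective eq)))))
    falls : ∀ L → Inv (suc k) ρ L → Compat (suc k) ρ L s →
            ExactlyOne (Cond j ρ L s) (map peak (splits L) ++ (map drise L ++ closings L))
    falls []      inv comp = ExactlyOneₚ.++⁺ˡ (peaks inv comp []) []
    falls (l ∷ R) inv comp@(compat agree (sl≤j ∷ low) (sx<sl ∷ decr)) with s l Finₚ.≟ j
    ... | no sl≢j = ExactlyOneₚ.++⁺ˡ
      (peaks inv comp (sl≢j ∷ All.map (λ sx<sl → below⇒≢ j inv (ℕₚ.<-≤-trans sx<sl (ℕ.s≤s⁻¹ sl≤j))) sx<sl))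
      (Allₚ.++⁺ (none-drise (l ∷ R) inv) (Allₚ.++⁺
        (Allₚ.map⁺ (All.universal (λ { _ (sl≡j , _) → sl≢j sl≡j }) (splits R)))
        (Allₚ.map⁺ (All.universal (λ { _ (sl≡j , _) → sl≢j sl≡j }) (l ∷ R)))))
    ... | yes sl≡j = ExactlyOneₚ.++⁺ʳ
      (Allₚ.map⁺ (All.universal (λ { _ (_ , sl≢j ∷ _ , _) → sl≢j sl≡j }) (splits (l ∷ R))))
      (ExactlyOneₚ.++⁺ʳ (none-drise (l ∷ R) inv) (ExactlyOneₚ.++⁺ˡ
        (ExactlyOneₚ.map⁺ (λ _ sep → sl≡j , sj<j , sep) (λ { _ (_ , _ , sep) → sep })
          (one-split-separates (toℕ ∘ s) decr
            (All.tabulate (λ x∈ eq → L≢j j inv (there x∈) (s-inj (Finₚ.toℕ-injective eq))))))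
        (Allₚ.map⁺ (All.tabulate (λ { l′∈ (_ , sj≡) →
          ℕₚ.<-asym sj<j (subst (λ x → k < toℕ x) (sym sj≡) (Inv.ρ-high inv (All.lookup (Inv.L-high inv) l′∈))) })))))
  ... | tri> sj≮j sj≢k sj>j = there (λ sj≡j → sj≢k (cong toℕ sj≡j))
    (ExactlyOneₚ.++⁺ʳ (Allₚ.map⁺ (All.universal (λ { _ (sj<j , _) → sj≮j sj<j }) (splits L)))
      (rises L inv comp (upper-image⇒open-start inv comp ℕₚ.≤-refl sj>j)))
    where
    rises : ∀ L → Inv (suc k) ρ L → Compat (suc k) ρ L s → (∃ λ l → l ∈ L × s j ≡ ρ l) →
            ExactlyOne (Cond j ρ L s) (map drise L ++ closings L)
    rises (l ∷ R) inv comp@(compat agree (sl≤j ∷ low) (sx<sl ∷ decr)) (y , y∈ , sj≡ρy) with s l Finₚ.≟ j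
    ... | no sl≢j = ExactlyOneₚ.++⁺ˡ
      (ExactlyOneₚ.map⁺
        (λ { _ refl → sj≡ρy , sl≢j ∷ All.map (λ sx<sl → below⇒≢ j inv (ℕₚ.<-≤-trans sx<sl (ℕ.s≤s⁻¹ sl≤j))) sx<sl })
        (λ { _ (sj≡ , _) → Inv.ρ-inj inv (trans (sym sj≡) sj≡ρy) })
        (ExactlyOneₚ.unique (Inv.L-uniq inv) y∈))
      (Allₚ.++⁺
        (Allₚ.map⁺ (All.universal (λ { _ (sl≡j , _) → sl≢j sl≡j }) (splits R)))
        (Allₚ.map⁺ (All.universal (λ { _ (sl≡j , _) → sl≢j sl≡j }) (l ∷ R))))
    ... | yes sl≡j = ExactlyOneₚ.++⁺ʳ
      (Allₚ.map⁺ (All.universal (λ { _ (_ , sl≢j ∷ _) → sl≢j sl≡j }) (l ∷ R)))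
      (ExactlyOneₚ.++⁺ʳ (Allₚ.map⁺ (All.universal (λ { _ (_ , sj<j , _) → sj≮j sj<j }) (splits R)))
        (ExactlyOneₚ.map⁺ (λ { _ refl → sl≡j , sj≡ρy })
          (λ { _ (_ , sj≡) → Inv.ρ-inj inv (trans (sym sj≡) sj≡ρy) })
          (ExactlyOneₚ.unique (Inv.L-uniq inv) y∈)))

-- Weights of extensions

module LocalStatistics {n : ℕ} (σ : Vec (Fin n) n) (s-inj : Injection (lookup σ)) (j : Fin n)
                       {ρ : Fin n → Fin n} {L : List (Fin n)}
                       (inv : Inv (suc (toℕ j)) ρ L) (comp : Compat (suc (toℕ j)) ρ L (lookup σ)) where
  open Inv inv
  open Compat comp
  open Statistics σ s-inj
  open DecMembership (Finₚ._≟_ {n}) using (_∈?_)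

  private
    s : Fin n → Fin n
    s = lookup σ
    k : ℕ
    k = toℕ j

  below≢above : ∀ {x y : Fin n} → toℕ x ≤ k → k < toℕ y → x ≢ y
  below≢above x≤k k<x refl = ℕₚ.<⇒≱ k<x x≤k

  starts-unique : Unique (map (toℕ ∘ ρ) L)
  starts-unique = Uniqueₚ.map⁺ (ρ-inj ∘ Finₚ.toℕ-injective) L-uniq

  module _ {xs ys : List (Fin n)} (uniq : Unique (xs ++ ys))
           (lower : ∀ {l} → l ∈ xs ++ ys → k < toℕ l × toℕ (s l) < k)
           (complete : ∀ {l} → k < toℕ l → toℕ (s l) < k → l ∈ xs ++ ys)
           (sj<j : toℕ (s j) < k) (sep : Separates (toℕ ∘ s) (toℕ (s j)) (xs , ys)) where

    -- The list is left open because the two uses differ: for a cycle peak it is `L`, for a double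
    -- fall the tail of `L`, since the head is sent to `j` itself and not below it.
    lcross-split : lcross σ j ≡ length xs
    lcross-split = trans (lcross-count j)
      (trans (∑ℕ.∑Fin-restrict uniq (λ l l∉ → ι-no (P? l) (λ { (j<l , sl<j , _) → l∉ (complete j<l sl<j) })))
      (trans (∑ℕ.∑-++ xs ys)
      (trans (cong₂ ℕ._+_
        (∑-one xs (λ {l} l∈ → ι-yes (P? l) (let (j<l , sl<j) = lower (∈-++⁺ˡ l∈) in j<l , sl<j , All.lookup (proj₁ sep) l∈)))
        (∑ℕ.∑-ε ys (λ {l} l∈ → ι-no (P? l) (λ { (_ , _ , sj<sl) → ℕₚ.<-asym sj<sl (All.lookup (proj₂ sep) l∈) }))))
      (ℕₚ.+-identityʳ _))))
      where P? = λ l → j Finₚ.<? l ×-dec s l Finₚ.<? j ×-dec s j Finₚ.<? s l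

    lnest-split : lnest σ j ≡ length ys
    lnest-split = trans (lnest-count j)
      (trans (∑ℕ.∑Fin-restrict uniq (λ l l∉ → ι-no (P? l)
        (λ { (j<l , _ , sl<sj) → l∉ (complete j<l (ℕₚ.<-trans sl<sj sj<j)) })))
      (trans (∑ℕ.∑-++ xs ys)
      (cong₂ ℕ._+_
        (∑ℕ.∑-ε xs (λ {l} l∈ → ι-no (P? l) (λ { (_ , _ , sl<sj) → ℕₚ.<-asym sl<sj (All.lookup (proj₁ sep) l∈) })))
        (∑-one ys (λ {l} l∈ → ι-yes (P? l) (proj₁ (lower (∈-++⁺ʳ xs l∈)) , sj<j , All.lookup (proj₂ sep) l∈))))))
      where P? = λ l → j Finₚ.<? l ×-dec s j Finₚ.<? j ×-dec s l Finₚ.<? s j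

  lower-complete : ∀ {l} → k < toℕ l → toℕ (s l) < k → l ∈ L
  lower-complete {l} k<l sl<k with l ∈? L
  ... | yes l∈ = l∈
  ... | no l∉  = contradiction (subst (λ x → k < toℕ x) (sym (agree l k<l l∉)) (ρ-high k<l)) (ℕₚ.<-asym sl<k)

  -- The state does not determine this preimage of an open start; the counts only need that it is at
  -- most `j` and that distinct starts have distinct sources.
  source : Fin n → Fin n
  source l = proj₁ (injection-surjective s-inj (ρ l))

  s-source : ∀ l → s (source l) ≡ ρ l
  s-source l = proj₂ (injection-surjective s-inj (ρ l))

  source-≤ : ∀ {l} → l ∈ L → toℕ (source l) ≤ k
  source-≤ {l} l∈ = open-start⇒source≤ j s-inj inv comp l∈ (s-source l)

  source-< : ∀ {l} → l ∈ L → ρ l ≢ s j → toℕ (source l) < k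
  source-< {l} l∈ ρl≢sj = ℕₚ.≤∧≢⇒< (source-≤ l∈)
    (λ eq → ρl≢sj (trans (sym (s-source l)) (cong s (Finₚ.toℕ-injective eq))))

  -- The indices below `j` with image above `j` are among the sources of the open starts. If σ(j) is
  -- itself an open start, `j` is a source as well, and the strict comparisons make its summand 0.
  ∑-over-sources : {f : Fin n → ℕ} (g : Fin n → ℕ) → (∀ i → ¬ (toℕ i < k × k < toℕ (s i)) → f i ≡ 0) →
                   (∀ {l} → l ∈ L → f (source l) ≡ g l) → ∑ℕ.∑ (allFin n) f ≡ ∑ℕ.∑ L g
  ∑-over-sources g vanish f≡g = trans
    (∑-transport source (Uniqueₚ.map⁺ source-inj L-uniq) (λ i i∉ → vanish i (λ { (i<k , k<si) → i∉ (hit i<k k<si) })))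
    (∑ℕ.∑-cong-∈ L f≡g)
    where
    source-inj : ∀ {x y} → source x ≡ source y → x ≡ y
    source-inj {x} {y} eq = ρ-inj (trans (sym (s-source x)) (trans (cong s eq) (s-source y)))
    hit : ∀ {i} → toℕ i < k → k < toℕ (s i) → i ∈ map source L
    hit i<k k<si with upper-image⇒open-start j s-inj inv comp (ℕₚ.<⇒≤ i<k) k<si
    ... | l , l∈ , si≡ρl = subst (_∈ map source L) (s-inj (trans (s-source l) (sym si≡ρl))) (∈-map⁺ source l∈)

  ucross-below : ucross σ j ≡ #below (toℕ ∘ ρ) L (toℕ (s j))
  ucross-below = trans (ucross-count j) (∑-over-sources _
      (λ i ¬up → ι-no (P? i) (λ { (i<j , j<si , _) → ¬up (i<j , j<si) }))
      (λ {l} l∈ → ι-cong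
        (λ { (_ , _ , lt) → subst (λ x → toℕ x < toℕ (s j)) (s-source l) lt })
        (λ lt → source-< l∈ (λ eq → ℕₚ.<-irrefl (cong toℕ eq) lt)
              , subst (λ x → k < toℕ x) (sym (s-source l)) (ρ-high (All.lookup L-high l∈))
              , subst (λ x → toℕ x < toℕ (s j)) (sym (s-source l)) lt)
        (P? (source l)) (toℕ (ρ l) <? toℕ (s j))))
    where P? = λ i → i Finₚ.<? j ×-dec j Finₚ.<? s i ×-dec s i Finₚ.<? s j

  unest-above : k < toℕ (s j) → unest σ j ≡ #above (toℕ ∘ ρ) L (toℕ (s j))
  unest-above j<sj = trans (unest-count j) (∑-over-sources _
      (λ i ¬up → ι-no (P? i) (λ { (i<j , j<sj , sj<si) → ¬up (i<j , ℕₚ.<-trans j<sj sj<si) }))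
      (λ {l} l∈ → ι-cong
        (λ { (_ , _ , lt) → subst (λ x → toℕ (s j) < toℕ x) (s-source l) lt })
        (λ lt → source-< l∈ (λ eq → ℕₚ.<-irrefl (cong toℕ (sym eq)) lt) , j<sj
              , subst (λ x → toℕ (s j) < toℕ x) (sym (s-source l)) lt)
        (P? (source l)) (toℕ (s j) <? toℕ (ρ l))))
    where P? = λ i → i Finₚ.<? j ×-dec j Finₚ.<? s j ×-dec s j Finₚ.<? s i

  psnest-fix : s j ≡ j → psnest σ j ≡ length L
  psnest-fix sj≡j = trans (psnest-count j) (trans (∑-over-sources (λ _ → 1)
      (λ i ¬up → ι-no (P? i) ¬up)
      (λ {l} l∈ → ι-yes (P? (source l))
        ( source-< l∈ (λ ρl≡sj → below≢above ℕₚ.≤-refl (ρ-high (All.lookup L-high l∈)) (sym (trans ρl≡sj sj≡j)))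
        , subst (λ x → k < toℕ x) (sym (s-source l)) (ρ-high (All.lookup L-high l∈)) )))
    (∑-one L (λ _ → refl)))
    where P? = λ i → i Finₚ.<? j ×-dec j Finₚ.<? s i

  preimage-below : ∀ {i} → All (λ l → s l ≢ j) L → s j ≢ j → s i ≡ j → toℕ i < k
  preimage-below {i} sl≢j sj≢j si≡j with k <? toℕ i
  ... | yes k<i = contradiction (ρ-inj (trans (sym (agree i k<i (λ i∈ → All.lookup sl≢j i∈ si≡j))) (trans si≡j (sym (ρj≡j j inv)))))
                                (below≢above ℕₚ.≤-refl k<i ∘ sym)
  ... | no k≮i  = ℕₚ.≤∧≢⇒< (ℕₚ.≮⇒≥ k≮i) (λ eq → sj≢j (trans (cong s (sym (Finₚ.toℕ-injective eq))) si≡j))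

  -- The orbit of `x` follows the path to its end `y` and then drops below `j`.
  path-descends : ∀ {x y} → k < toℕ x → Path ρ L x y → toℕ (s y) < k → ∃ λ m → toℕ (iter σ m x) < k
  path-descends k<x []        sy<k = 1 , sy<k
  path-descends {x} k<x (x∉ ∷ p) sy<k with path-descends (ρ-high k<x) p sy<k
  ... | m , lt = m ℕ.+ 1 , subst (λ z → toℕ z < k)
    (trans (cong (iter σ m) (sym (agree x k<x x∉))) (sym (iter-+ m 1 x))) lt

  -- When the path leads from σ(j) to the end sent to `j`, the set of `j` and the points along that
  -- path is closed under σ.
  path-closes : ∀ {l} → s l ≡ j → Path ρ L (s j) l → k < toℕ (s j) → ∀ m → k ≤ toℕ (iter σ m j)
  path-closes {l} sl≡j p k<sj m = bound (closed m)
    where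
    On : Fin n → Set
    On x = x ≡ j ⊎ (k < toℕ x × Path ρ L x l)
    bound : ∀ {x} → On x → k ≤ toℕ x
    bound (inj₁ refl)      = ℕₚ.≤-refl
    bound (inj₂ (k<x , _)) = ℕₚ.<⇒≤ k<x
    step : ∀ {x} → On x → On (s x)
    step (inj₁ refl)                  = inj₂ (k<sj , p)
    step (inj₂ (k<x , []))            = inj₁ sl≡j
    step {x} (inj₂ (k<x , (x∉ ∷ q))) =
      inj₂ (subst (λ z → k < toℕ z × Path ρ L z l) (sym (agree x k<x x∉)) (ρ-high k<x , q))
    closed : ∀ m → On (iter σ m j)
    closed zero    = inj₁ refl
    closed (suc m) = step (closed m)

  not-cycleMin-rise : ∀ {l} → l ∈ L → s j ≡ ρ l → toℕ (s l) < k → isCycleMin σ j ≡ false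
  not-cycleMin-rise {l} l∈ sj≡ρl sl<k with path-descends (ρ-high (All.lookup L-high l∈)) (L-path l∈) sl<k
  ... | m , lt = isCycleMin-false (m ℕ.+ 1)
    (subst (λ z → toℕ z < k) (trans (cong (iter σ m) (sym sj≡ρl)) (sym (iter-+ m 1 j))) lt)

module ChoiceWeights {ℓ₁ ℓ₂ : Level} (R : CommutativeRing ℓ₁ ℓ₂) where
  open CommutativeRing R renaming (refl to ≈-refl; sym to ≈-sym; trans to ≈-trans)
  open WithRing R
  open Weights R
  open SemiringSolver commutativeSemiring using (solve; _:=_; _:*_; con)

  module _ (lam : Carrier) (a : ℕ → Carrier) (b c d : ℕ → ℕ → Carrier) (e : ℕ → Carrier) where

    choiceWeight : ∀ {n} → (Fin n → Fin n) → List (Fin n) → Choice → Carrier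
    choiceWeight ρ L fix                 = lam * e (length L)
    choiceWeight ρ L (peak (xs , ys))    = b (length xs) (length ys)
    choiceWeight ρ L (drise l′)          = d (#below (toℕ ∘ ρ) L (toℕ (ρ l′))) (#above (toℕ ∘ ρ) L (toℕ (ρ l′)))
    choiceWeight ρ L (dfall l (xs , ys)) = c (length xs) (length ys)
    choiceWeight ρ L (val l R l′)        = when (does (l Finₚ.≟ l′)) lam * a (length R)

    -- With every test replaced by its known value, the factors that do not apply compute to `1#`; a
    -- statistic occurring only in those is passed as itself.
    localWeight-by-type : ∀ {n} (σ : Vec (Fin n) n) {j : Fin n} {min lt gt dn up eq : Bool} {u lc ln uc un ps : ℕ} →
      isCycleMin σ j ≡ min → inv< σ j ≡ lt → inv> σ j ≡ gt →
      (lookup σ j <ᶠ j) ≡ dn → (j <ᶠ lookup σ j) ≡ up → (lookup σ j =ᶠ j) ≡ eq →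
      ucross σ j ℕ.+ unest σ j ≡ u → lcross σ j ≡ lc → lnest σ j ≡ ln →
      ucross σ j ≡ uc → unest σ j ≡ un → psnest σ j ≡ ps →
      localWeight lam a b c d e σ j ≈
        when min lam * when (gt ∧ up) (a u) * when (lt ∧ dn) (b lc ln) * when (gt ∧ dn) (c lc ln)
        * when (lt ∧ up) (d uc un) * when eq (e ps)
    localWeight-by-type σ refl refl refl refl refl refl refl refl refl refl refl refl = ≈-refl

    module _ {n : ℕ} (σ : Vec (Fin n) n) (s-inj : Injection (lookup σ)) (j : Fin n)
             {ρ : Fin n → Fin n} {L : List (Fin n)}
             (inv : Inv (suc (toℕ j)) ρ L) (comp : Compat (suc (toℕ j)) ρ L (lookup σ)) where
      open Inv inv
      open Compat comp
      open LocalStatistics σ s-inj j inv comp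
      open Statistics σ s-inj

      private
        s : Fin n → Fin n
        s = lookup σ
        k : ℕ
        k = toℕ j
        lt-yes : ∀ {x y : Fin n} → toℕ x < toℕ y → (x <ᶠ y) ≡ true
        lt-yes {x} {y} = dec-true (x Finₚ.<? y)
        lt-no : ∀ {x y : Fin n} → ¬ (toℕ x < toℕ y) → (x <ᶠ y) ≡ false
        lt-no {x} {y} = dec-false (x Finₚ.<? y)
        eq-yes : ∀ {x y : Fin n} → x ≡ y → (x =ᶠ y) ≡ true
        eq-yes {x} {y} x≡y = dec-true (toℕ x ℕ.≟ toℕ y) (cong toℕ x≡y)
        eq-no : ∀ {x y : Fin n} → x ≢ y → (x =ᶠ y) ≡ false
        eq-no {x} {y} x≢y = dec-false (toℕ x ℕ.≟ toℕ y) (x≢y ∘ Finₚ.toℕ-injective)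

      localWeight-choice : ∀ {ch} → Allowed ch L → Cond j ρ L s ch →
                           localWeight lam a b c d e σ j ≈ choiceWeight ρ L ch
      localWeight-choice fix sj≡j = ≈-trans
        (localWeight-by-type σ (isCycleMin-true (λ m → ℕₚ.≤-reflexive (cong toℕ (sym (stays m)))))
          (trans (inv<-preimage sj≡j) (lt-no {j} {j} (ℕₚ.<-irrefl refl))) (trans (inv>-preimage sj≡j) (lt-no {j} {j} (ℕₚ.<-irrefl refl)))
          (lt-no (ℕₚ.<-irrefl (cong toℕ sj≡j))) (lt-no (ℕₚ.<-irrefl (cong toℕ (sym sj≡j)))) (eq-yes sj≡j)
          refl refl refl refl refl (psnest-fix sj≡j))
        (solve 2 (λ x y → x :* con 1 :* con 1 :* con 1 :* con 1 :* y := x :* y) ≈-refl lam (e (length L)))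
        where
        stays : ∀ m → iter σ m j ≡ j
        stays zero    = refl
        stays (suc m) = trans (cong s (stays m)) sj≡j
      localWeight-choice (peak xs ys) (sj<j , sl≢j , sep) with injection-surjective s-inj j
      ... | i , si≡j = ≈-trans
        (localWeight-by-type σ (isCycleMin-false 1 sj<j)
          (trans (inv<-preimage si≡j) (lt-yes i<j)) (trans (inv>-preimage si≡j) (lt-no (ℕₚ.<-asym i<j)))
          (lt-yes sj<j) (lt-no (ℕₚ.<-asym sj<j)) (eq-no (below⇒≢ j inv sj<j))
          refl (lcross-split L-uniq lower lower-complete sj<j sep) (lnest-split L-uniq lower lower-complete sj<j sep)
          refl refl refl)
        (solve 1 (λ x → con 1 :* con 1 :* x :* con 1 :* con 1 :* con 1 := x) ≈-refl (b (length xs) (length ys)))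
        where
        i<j : toℕ i < k
        i<j = preimage-below sl≢j (below⇒≢ j inv sj<j) si≡j
        lower : ∀ {l} → l ∈ xs ++ ys → k < toℕ l × toℕ (s l) < k
        lower l∈ = All.lookup L-high l∈ , ≢⇒below j inv (All.lookup low l∈) (All.lookup sl≢j l∈)
      localWeight-choice (drise {l′ = l′} l′∈) (sj≡ , sl≢j) with injection-surjective s-inj j
      ... | i , si≡j = ≈-trans
        (localWeight-by-type σ
          (not-cycleMin-rise l′∈ sj≡ (≢⇒below j inv (All.lookup low l′∈) (All.lookup sl≢j l′∈)))
          (trans (inv<-preimage si≡j) (lt-yes i<j)) (trans (inv>-preimage si≡j) (lt-no (ℕₚ.<-asym i<j)))
          (lt-no (ℕₚ.<-asym j<sj)) (lt-yes j<sj) (eq-no (above⇒≢ j inv j<sj))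
          refl refl refl (trans ucross-below (cong (#below (toℕ ∘ ρ) L ∘ toℕ) sj≡))
          (trans (unest-above j<sj) (cong (#above (toℕ ∘ ρ) L ∘ toℕ) sj≡)) refl)
        (solve 1 (λ x → con 1 :* con 1 :* con 1 :* con 1 :* x :* con 1 := x) ≈-refl
          (d (#below (toℕ ∘ ρ) L (toℕ (ρ l′))) (#above (toℕ ∘ ρ) L (toℕ (ρ l′)))))
        where
        j<sj : k < toℕ (s j)
        j<sj = subst (λ x → k < toℕ x) (sym sj≡) (ρ-high (All.lookup L-high l′∈))
        i<j : toℕ i < k
        i<j = preimage-below sl≢j (above⇒≢ j inv j<sj) si≡j
      localWeight-choice (dfall {l} xs ys) (sl≡j , sj<j , sep) with L-uniq | decr
      ... | l∉ ∷ R-uniq | sx<sl ∷ _ = ≈-trans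
        (localWeight-by-type σ (isCycleMin-false 1 sj<j)
          (trans (inv<-preimage sl≡j) (lt-no (ℕₚ.<-asym j<l))) (trans (inv>-preimage sl≡j) (lt-yes j<l))
          (lt-yes sj<j) (lt-no (ℕₚ.<-asym sj<j)) (eq-no (below⇒≢ j inv sj<j))
          refl (lcross-split R-uniq lower complete sj<j sep) (lnest-split R-uniq lower complete sj<j sep)
          refl refl refl)
        (solve 1 (λ x → con 1 :* con 1 :* con 1 :* x :* con 1 :* con 1 := x) ≈-refl (c (length xs) (length ys)))
        where
        j<l : k < toℕ l
        j<l = All.head L-high
        lower : ∀ {x} → x ∈ xs ++ ys → k < toℕ x × toℕ (s x) < k
        lower x∈ = All.lookup (All.tail L-high) x∈ , subst (λ z → _ < toℕ z) sl≡j (All.lookup sx<sl x∈)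
        complete : ∀ {x} → k < toℕ x → toℕ (s x) < k → x ∈ xs ++ ys
        complete k<x sx<k with lower-complete k<x sx<k
        ... | here refl = contradiction sx<k (ℕₚ.<-irrefl (cong toℕ sl≡j))
        ... | there x∈  = x∈
      localWeight-choice (val {l} {R} {l′} l′∈) (sl≡j , sj≡) with decr
      ... | sx<sl ∷ _ = ≈-trans
        (localWeight-by-type σ minimal
          (trans (inv<-preimage sl≡j) (lt-no (ℕₚ.<-asym j<l))) (trans (inv>-preimage sl≡j) (lt-yes j<l))
          (lt-no (ℕₚ.<-asym j<sj)) (lt-yes j<sj) (eq-no (above⇒≢ j inv j<sj))
          a-index refl refl refl refl refl)
        (solve 2 (λ x y → x :* y :* con 1 :* con 1 :* con 1 :* con 1 := x :* y) ≈-refl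
          (when (does (l Finₚ.≟ l′)) lam) (a (length R)))
        where
        j<l : k < toℕ l
        j<l = All.head L-high
        j<sj : k < toℕ (s j)
        j<sj = subst (λ x → k < toℕ x) (sym sj≡) (ρ-high (All.lookup L-high l′∈))
        -- Of all open starts only σ(j) is neither below nor above itself, so the index is one less
        -- than the height, whichever `l′` is chosen.
        a-index : ucross σ j ℕ.+ unest σ j ≡ length R
        a-index = trans (cong₂ ℕ._+_ ucross-below (unest-above j<sj))
          (trans (cong (λ x → #below (toℕ ∘ ρ) (l ∷ R) (toℕ x) ℕ.+ #above (toℕ ∘ ρ) (l ∷ R) (toℕ x)) sj≡)
          (ℕₚ.suc-injective (#below+#above (toℕ ∘ ρ) starts-unique l′∈)))
        -- If the start belongs to the path of `l`, the orbit comes back through `l` to `j`;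
        -- otherwise it runs to another end, whose image is below that of `l`, which is `j`.
        minimal : isCycleMin σ j ≡ does (l Finₚ.≟ l′)
        minimal with l Finₚ.≟ l′
        ... | yes refl = isCycleMin-true (path-closes sl≡j (subst (λ z → Path ρ (l ∷ R) z l) (sym sj≡) (L-path l′∈)) j<sj)
        ... | no l≢l′  = not-cycleMin-rise l′∈ sj≡
          (subst (λ z → _ < toℕ z) sl≡j (All.lookup sx<sl (Any.tail (l≢l′ ∘ sym) l′∈)))

-- Sums over completions

module Completions {ℓ₁ ℓ₂ : Level} (R : CommutativeRing ℓ₁ ℓ₂)
    (lam : CommutativeRing.Carrier R) (a : ℕ → CommutativeRing.Carrier R)
    (b c d : ℕ → ℕ → CommutativeRing.Carrier R) (e : ℕ → CommutativeRing.Carrier R) where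
  open CommutativeRing R renaming (refl to ≈-refl; sym to ≈-sym; trans to ≈-trans)
  open WithRing R
  open SetoidReasoning setoid
  open Fractions R
  open RankSums +-commutativeMonoid
  open Weights R
  open ChoiceWeights R
  open SemiringSolver commutativeSemiring using (solve; _:=_; _:+_; _:*_; con)

  indicator : ∀ {p} {P : Set p} → Dec P → Carrier
  indicator P? = if does P? then 1# else 0#

  indicator-yes : ∀ {p} {P : Set p} (P? : Dec P) → P → indicator P? ≈ 1#
  indicator-yes P? pr = reflexive (cong (if_then 1# else 0#) (dec-true P? pr))

  indicator-no : ∀ {p} {P : Set p} (P? : Dec P) → ¬ P → indicator P? ≈ 0#
  indicator-no P? ¬pr = reflexive (cong (if_then 1# else 0#) (dec-false P? ¬pr))

  -- `βseq lam a b (suc h)` is `fall h * rise h` by computation. A fall leaves height h + 1: of the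
  -- h + 1 starts one closes a cycle and contributes λ, each of the other h contributes 1.
  rise fall : ℕ → Carrier
  rise h = antidiagonal h b
  fall h = (lam + natR h) * a h

  paths : ℕ → ℕ → Carrier
  paths = motzkin (γseq lam c d e) rise fall

  module _ {n : ℕ} where

    -- Fixed points, `drise` and `dfall` keep the height and give the three terms of γ; peaks give
    -- the rise and valleys the fall. With no open path only `fix` and `peak` remain. The total no
    -- longer involves `ρ`, as the induction requires.
    ∑-choices : ∀ (j : Fin n) (ρ : Fin n → Fin n) {L} → Injection ρ → Unique L → ∀ k →
                ∑ (choices L) (λ ch → choiceWeight lam a b c d e ρ L ch * paths k (length (nextL j ch L)))
                ≈ paths (suc k) (length L)
    ∑-choices j ρ {L} ρ-inj L-uniq k = begin
      lam * e h * paths k h + ∑ (map peak (splits L) ++ (map drise L ++ closings L)) term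
        ≈⟨ +-congˡ (≈-trans (∑-++ (map peak (splits L)) _) (+-congˡ (∑-++ (map drise L) (closings L)))) ⟩
      lam * e h * paths k h + (∑ (map peak (splits L)) term + (∑ (map drise L) term + ∑ (closings L) term))
        ≈⟨ +-congˡ (+-cong peaks (+-congʳ drises)) ⟩
      lam * e h * paths k h + (rise h * paths k (suc h) + (ranks h d * paths k h + ∑ (closings L) term))
        ≈⟨ close L L-uniq ⟩
      paths (suc k) h ∎
      where
      h : ℕ
      h = length L
      term : Choice → Carrier
      term ch = choiceWeight lam a b c d e ρ L ch * paths k (length (nextL j ch L))
      splits-sum : (f : ℕ → ℕ → Carrier) (R : List (Fin n)) →
        ∑ (splits R) (λ sp → f (length (proj₁ sp)) (length (proj₂ sp)) * paths k (length (proj₁ sp ++ j ∷ proj₂ sp)))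
        ≈ antidiagonal (length R) f * paths k (suc (length R))
      splits-sum f R = begin
        ∑ (splits R) (λ sp → f (length (proj₁ sp)) (length (proj₂ sp)) * paths k (length (proj₁ sp ++ j ∷ proj₂ sp)))
          ≈⟨ ∑-cong-∈ (splits R) (λ {sp} sp∈ → *-congˡ (reflexive (cong (paths k) (lengths sp sp∈)))) ⟩
        ∑ (splits R) (λ sp → f (length (proj₁ sp)) (length (proj₂ sp)) * paths k (suc (length R)))
          ≈⟨ ∑-* (splits R) (paths k (suc (length R))) ⟨
        ∑ (splits R) (λ sp → f (length (proj₁ sp)) (length (proj₂ sp))) * paths k (suc (length R))
          ≈⟨ *-congʳ (∑-splits R f) ⟩
        antidiagonal (length R) f * paths k (suc (length R)) ∎
        where
        lengths : ∀ sp → sp ∈ splits R → length (proj₁ sp ++ j ∷ proj₂ sp) ≡ suc (length R)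
        lengths (xs , ys) sp∈ = trans (Listₚ.length-++-sucʳ xs j ys) (cong (suc ∘ length) (splits-++ R sp∈))
      peaks : ∑ (map peak (splits L)) term ≈ rise h * paths k (suc h)
      peaks = ≈-trans (reflexive (∑-map peak (splits L))) (splits-sum b L)
      drises : ∑ (map drise L) term ≈ ranks h d * paths k h
      drises = ≈-trans (reflexive (∑-map drise L)) (≈-trans (≈-sym (∑-* L (paths k h)))
        (*-congʳ (∑-ranks (toℕ ∘ ρ) (Uniqueₚ.map⁺ (ρ-inj ∘ Finₚ.toℕ-injective) L-uniq) d)))
      close : ∀ L′ → Unique L′ →
        lam * e (length L′) * paths k (length L′) + (rise (length L′) * paths k (suc (length L′))
          + (ranks (length L′) d * paths k (length L′) + ∑ (closings L′) term))
        ≈ paths (suc k) (length L′)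
      close [] _ = solve 3 (λ x p y → x :* p :+ (y :+ (con 0 :* p :+ con 0)) := x :* p :+ y :+ con 0) ≈-refl _ _ _
      close (l ∷ R) (l∉ ∷ _) = ≈-trans
        (+-congˡ (+-congˡ (+-congˡ (≈-trans (∑-++ (map (dfall l) (splits R)) _) (+-cong dfalls vals)))))
        (solve 6 (λ x p y D C F → x :* p :+ (y :+ (D :* p :+ (C :* p :+ F))) := (C :+ D :+ x) :* p :+ y :+ F)
          ≈-refl _ _ _ _ _ _)
        where
        m : ℕ
        m = length R
        dfalls : ∑ (map (dfall l) (splits R)) term ≈ antidiagonal m c * paths k (suc m)
        dfalls = ≈-trans (reflexive (∑-map (dfall l) (splits R))) (splits-sum c R)
        -- The starts not on the path of `l`: each contributes `a m` without a factor λ.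
        non-closing : ∀ xs → All (l ≢_) xs →
          ∑ xs (λ l′ → when (does (l Finₚ.≟ l′)) lam * a m * paths k m) ≈ natR (length xs) * (a m * paths k m)
        non-closing []       []            = ≈-sym (zeroˡ _)
        non-closing (x ∷ xs) (l≢x ∷ l≢xs) = ≈-trans
          (+-cong (*-congʳ (*-congʳ (reflexive (cong (λ t → when t lam) (dec-false (l Finₚ.≟ x) l≢x))))) (non-closing xs l≢xs))
          (solve 3 (λ x p q → con 1 :* x :* p :+ q :* (x :* p) := (con 1 :+ q) :* (x :* p)) ≈-refl _ _ _)
        vals : ∑ (map (val l R) (l ∷ R)) term ≈ fall m * paths k m
        vals = ≈-trans (reflexive (∑-map (val l R) (l ∷ R))) (≈-trans
          (+-cong (*-congʳ (*-congʳ (reflexive (cong (λ t → when t lam) (dec-true (l Finₚ.≟ l) refl))))) (non-closing R l∉))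
          (solve 4 (λ x y p q → x :* y :* p :+ q :* (y :* p) := (x :+ q) :* y :* p) ≈-refl _ _ _ _))

    contribution : ℕ → (Fin n → Fin n) → List (Fin n) → Vec (Fin n) n → Carrier
    contribution k ρ L σ = if isInjective σ
      then indicator (compat? k ρ L (lookup σ)) * weightBelow lam a b c d e k σ else 0#

    completions : ℕ → (Fin n → Fin n) → List (Fin n) → Carrier
    completions k ρ L = ∑ (allVecs n n) (contribution k ρ L)

    -- A permutation compatible with the state falls under exactly one choice, whose weight is its
    -- local weight at `j`; an incompatible one is compatible with no extension.
    contribution-suc : ∀ (j : Fin n) {ρ L} → Inv (suc (toℕ j)) ρ L → ∀ σ →
      contribution (suc (toℕ j)) ρ L σ ≈
      ∑ (choices L) (λ ch → choiceWeight lam a b c d e ρ L ch * contribution (toℕ j) (nextρ j ch ρ) (nextL j ch L) σ)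
    contribution-suc j {ρ} {L} inv σ with isInjective σ in ok
    ... | false = ≈-sym (∑-ε (choices L) (λ _ → zeroʳ _))
    ... | true  = go (compat? (suc (toℕ j)) ρ L s)
      where
      s : Fin n → Fin n
      s = lookup σ
      s-inj : Injection s
      s-inj = isInjective⇒injection σ ok
      W : ℕ → Carrier
      W k = weightBelow lam a b c d e k σ
      next? : ∀ ch → Dec (Compat (toℕ j) (nextρ j ch ρ) (nextL j ch L) s)
      next? ch = compat? (toℕ j) (nextρ j ch ρ) (nextL j ch L) s
      excluded : ∀ ch → ¬ Compat (toℕ j) (nextρ j ch ρ) (nextL j ch L) s →
                 choiceWeight lam a b c d e ρ L ch * (indicator (next? ch) * W (toℕ j)) ≈ 0#
      excluded ch ¬next = ≈-trans (*-congˡ (≈-trans (*-congʳ (indicator-no (next? ch) ¬next)) (zeroˡ _))) (zeroʳ _)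
      go : (comp? : Dec (Compat (suc (toℕ j)) ρ L s)) → indicator comp? * W (suc (toℕ j)) ≈
           ∑ (choices L) (λ ch → choiceWeight lam a b c d e ρ L ch * (indicator (next? ch) * W (toℕ j)))
      go (no ¬comp) = ≈-trans (zeroˡ _) (≈-sym (∑-ε (choices L) (λ {ch} ch∈ →
        excluded ch (¬comp ∘ proj₁ ∘ compat-next⁻ j s-inj inv (choices-allowed L ch∈)))))
      go (yes comp) = ≈-sym (∑-exactlyOne (one-choice j s-inj inv comp)
        (λ {ch} ch∈ cond → begin
          choiceWeight lam a b c d e ρ L ch * (indicator (next? ch) * W (toℕ j))
            ≈⟨ *-congˡ (*-congʳ (indicator-yes (next? ch) (compat-next⁺ j s-inj inv (choices-allowed L ch∈) comp cond))) ⟩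
          choiceWeight lam a b c d e ρ L ch * (1# * W (toℕ j))
            ≈⟨ *-cong (≈-sym (localWeight-choice lam a b c d e σ s-inj j inv comp (choices-allowed L ch∈) cond)) (*-identityˡ _) ⟩
          localWeight lam a b c d e σ j * W (toℕ j)
            ≈⟨ weightBelow-suc lam a b c d e σ j ⟨
          W (suc (toℕ j))
            ≈⟨ *-identityˡ _ ⟨
          1# * W (suc (toℕ j)) ∎)
        (λ {ch} ch∈ ¬cond → excluded ch (¬cond ∘ proj₂ ∘ compat-next⁻ j s-inj inv (choices-allowed L ch∈))))

    completions-suc : ∀ (j : Fin n) {ρ L} → Inv (suc (toℕ j)) ρ L → completions (suc (toℕ j)) ρ L ≈
      ∑ (choices L) (λ ch → choiceWeight lam a b c d e ρ L ch * completions (toℕ j) (nextρ j ch ρ) (nextL j ch L))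
    completions-suc j {ρ} {L} inv = begin
      completions (suc (toℕ j)) ρ L
        ≈⟨ ∑-cong (allVecs n n) (contribution-suc j inv) ⟩
      ∑ (allVecs n n) (λ σ → ∑ (choices L) (λ ch →
        choiceWeight lam a b c d e ρ L ch * contribution (toℕ j) (nextρ j ch ρ) (nextL j ch L) σ))
        ≈⟨ ∑-swap (allVecs n n) (choices L) _ ⟩
      ∑ (choices L) (λ ch → ∑ (allVecs n n) (λ σ →
        choiceWeight lam a b c d e ρ L ch * contribution (toℕ j) (nextρ j ch ρ) (nextL j ch L) σ))
        ≈⟨ ∑-cong (choices L) (λ ch → *-∑ (allVecs n n) _) ⟨
      ∑ (choices L) (λ ch → choiceWeight lam a b c d e ρ L ch * completions (toℕ j) (nextρ j ch ρ) (nextL j ch L)) ∎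

    -- At `k = 0` an open end would need an image below 0, hence the value 0 at positive height;
    -- with no end left, `ρ` itself is the only completion.
    completions-zero : ∀ {ρ L} → Inv 0 ρ L → completions 0 ρ L ≈ paths 0 (length L)
    completions-zero {ρ} {l ∷ R} inv = ∑-ε (allVecs n n) (λ {σ} _ → none σ)
      where
      none : ∀ σ → contribution 0 ρ (l ∷ R) σ ≈ 0#
      none σ with isInjective σ
      ... | false = ≈-refl
      ... | true  = ≈-trans (*-congʳ (indicator-no (compat? 0 ρ (l ∷ R) (lookup σ)) (λ { (compat _ (() ∷ _) _) }))) (zeroˡ _)
    completions-zero {ρ} {[]} inv = ≈-trans (∑-allVecs-single (tabulate ρ) others) itself
      where
      others : ∀ σ → σ ≢ tabulate ρ → contribution 0 ρ [] σ ≈ 0#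
      others σ σ≢ with isInjective σ
      ... | false = ≈-refl
      ... | true  = ≈-trans (*-congʳ (indicator-no (compat? 0 ρ [] (lookup σ)) (λ { (compat agree _ _) →
        σ≢ (trans (sym (Vecₚ.tabulate∘lookup σ)) (Vecₚ.tabulate-cong (λ i → agree i z≤n (λ ())))) }))) (zeroˡ _)
      lookup-ρ : ∀ i → lookup (tabulate ρ) i ≡ ρ i
      lookup-ρ = Vecₚ.lookup∘tabulate ρ
      itself : contribution 0 ρ [] (tabulate ρ) ≈ 1#
      itself rewrite injection⇒isInjective (tabulate ρ) (λ {i} {j} eq →
                       Inv.ρ-inj inv (trans (sym (lookup-ρ i)) (trans eq (lookup-ρ j)))) =
        ≈-trans (*-cong (indicator-yes (compat? 0 ρ [] (lookup (tabulate ρ))) (compat (λ i _ _ → lookup-ρ i) [] []))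
                        (weightBelow-zero lam a b c d e (tabulate ρ)))
                (*-identityˡ _)

    completions≈paths : ∀ k → k ≤ n → ∀ {ρ L} → Inv k ρ L → completions k ρ L ≈ paths k (length L)
    completions≈paths zero    _   inv = completions-zero inv
    completions≈paths (suc k) k<n {ρ} {L} inv = at (fromℕ< k<n) (Finₚ.toℕ-fromℕ< k<n) inv
      where
      -- Matching the equation with `refl` turns `k` into `toℕ j`, the form used by the one-step
      -- lemmas.
      at : (j : Fin n) → toℕ j ≡ k → Inv (suc k) ρ L → completions (suc k) ρ L ≈ paths (suc k) (length L)
      at j refl inv = begin
        completions (suc k) ρ L
          ≈⟨ completions-suc j inv ⟩
        ∑ (choices L) (λ ch → choiceWeight lam a b c d e ρ L ch * completions k (nextρ j ch ρ) (nextL j ch L))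
          ≈⟨ ∑-cong-∈ (choices L) (λ ch∈ → *-congˡ
               (completions≈paths k (ℕₚ.<⇒≤ k<n) (inv-next j (choices-allowed L ch∈) inv))) ⟩
        ∑ (choices L) (λ ch → choiceWeight lam a b c d e ρ L ch * paths k (length (nextL j ch L)))
          ≈⟨ ∑-choices j ρ (Inv.ρ-inj inv) (Inv.L-uniq inv) k ⟩
        paths (suc k) (length L) ∎

  -- At `k = n` nothing is decided, so every permutation is compatible with the identity and no
  -- ends.
  Qhat≈completions : ∀ n → Qhat lam a b c d e n ≈ completions {n} n id []
  Qhat≈completions n = ≈-trans (∑-filterᵇ isInjective (allVecs n n)) (∑-cong (allVecs n n) all)
    where
    all : ∀ σ → (if isInjective σ then weight lam a b c d e σ else 0#) ≈ contribution n id [] σ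
    all σ with isInjective σ
    ... | false = ≈-refl
    ... | true  = ≈-trans (weightBelow-all lam a b c d e σ) (≈-sym (≈-trans
      (*-congʳ (indicator-yes (compat? n id [] (lookup σ))
        (compat (λ i n≤i _ → contradiction n≤i (ℕₚ.<⇒≱ (Finₚ.toℕ<n i))) [] [])))
      (*-identityˡ _)))

  Qhat≈paths : ∀ n → Qhat lam a b c d e n ≈ paths n 0
  Qhat≈paths n = ≈-trans (Qhat≈completions n) (completions≈paths n ℕₚ.≤-refl record
    { ρ-inj = id ; ρ-fixes = λ _ _ → refl ; L-high = [] ; L-uniq = [] ; L-path = λ () })

theorem3p3 : {ℓ₁ ℓ₂ : Level} (R : CommutativeRing ℓ₁ ℓ₂) →
    let open CommutativeRing R
        open WithRing R
    in (lam : Carrier) (a : ℕ → Carrier) (b c d : ℕ → ℕ → Carrier) (e : ℕ → Carrier) →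
       (n N : ℕ) → n < N →
       Qhat lam a b c d e n ≈ Jfrac (γseq lam c d e) (βseq lam a b) N 0 n
theorem3p3 R lam a b c d e n N n<N =
  CommutativeRing.trans R (Qhat≈paths n)
    (CommutativeRing.sym R (Fractions.Jfrac≈motzkin R _ _ rise fall (λ _ → CommutativeRing.refl R) n N n<N))
  where open Completions R lam a b c d e
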